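{- Let $S$ be a finite N-step set such that $\max_{s\in S}\min(s)\le0$, and such that the sets of reachable points of N-meanders on $S$ are described by finitely many types, i.e. there is a finite collection of types $\mathcal T(n_i,k_i,\mathbf a_i,\mathbf b_i,\mathbf c_i)$ such that the set of reachable points of every N-meander on $S$ belongs to one of them. Then the generating function of N-excursions on $S$ (by length) is algebraic.
   Context: An N-step is a non-empty finite set of integers. For a finite set $S$ of N-steps, an N-walk is a finite sequence $(s_1,\dots,s_n)$ of elements of $S$ starting at $0$. A classical walk $(v_1,\dots,v_n)$ with positions $\omega_k=\sum_{i\le k}v_i$ is compatible if $v_i\in s_i$ for all $i$; it is a meander if all $\omega_k\ge0$, an excursion if moreover $\omega_n=0$. An N-meander (resp. N-excursion) is an N-walk compatible with at least one meander (resp. excursion); its set of reachable points is the set of endpoints of all compatible meanders. For finite integer sets, $\mathbf s+\mathbf t=\{a+b:a\in\mathbf s,b\in\mathbf t\}$; for an integer $j\ge0$, $j\times\mathbf s$ is the $j$-fold sumset of $\mathbf s$ with itself ($0\times\mathbf s=\{0\}$). Bottom pruning: $\mathbf s\ominus\mathbf t=\emptyset$ if $\mathbf s=\emptyset$, else $\mathbf s\setminus(\{\min\mathbf s\}+\mathbf t)$. Top pruning: $\mathbf s\ominus'\mathbf t=\emptyset$ if $\mathbf s=\emptyset$, else $\mathbf s\setminus\{\max\mathbf s-b: b\in\mathbf t\}$. For integers $n,k\ge0$ and finite integer sets $\mathbf a,\mathbf b,\mathbf c$, the type is $\mathcal T(n,k,\mathbf a,\mathbf b,\mathbf c)=\{((j\times\{0,n\}+\mathbf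 b)\ominus\mathbf a)\ominus'\mathbf c+\{m\}: m\in\mathbb Z,\ j\in\mathbb Z_{\ge k}\}$. -}

module Defs where

open import Data.Nat as ℕ using (ℕ; zero; suc; _∸_)
open import Data.Integer as ℤ using (ℤ; +_; 0ℤ; 1ℤ; _⊓_; _⊔_; _+_; _-_; _*_; _≤_; _<_)
open import Data.List using (List; []; _∷_; map; concatMap; foldr; filter; length)
open import Data.List.Membership.Propositional using (_∈_)
open import Data.List.Membership.DecPropositional ℤ._≟_ using (_∈?_)
open import Data.List.Relation.Unary.All using (All)
open import Data.List.Relation.Unary.Any using (Any)
open import Data.List.Relation.Unary.Linked using (Linked)
open import Data.List.Relation.Unary.Unique.Propositional using (Unique)
open import Data.List.Relation.Binary.Pointwise using (Pointwise)
open import Data.Product using (Σ; ∃; _×_; _,_)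
open import Relation.Binary.PropositionalEquality using (_≡_; _≢_)
open import Relation.Nullary using (¬?)
open import Function.Bundles using (_⇔_)

-- A finite set of integers is represented canonically as a strictly
-- increasing list; an N-step is a non-empty such set.
IsNStep : List ℤ → Set
IsNStep s = (s ≢ []) × Linked _<_ s

IsNStepSet : List (List ℤ) → Set
IsNStepSet S = All IsNStep S × Unique S

IsNWalk : List (List ℤ) → List (List ℤ) → Set
IsNWalk S w = All (_∈ S) w

Compatible : List ℤ → List (List ℤ) → Set
Compatible vs w = Pointwise _∈_ vs w

positionsFrom : ℤ → List ℤ → List ℤ
positionsFrom h [] = []
positionsFrom h (v ∷ vs) = (h + v) ∷ positionsFrom (h + v) vs

positions : List ℤ → List ℤ
positions = positionsFrom 0ℤ

endpoint : List ℤ → ℤ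
endpoint = foldr _+_ 0ℤ

IsMeander : List ℤ → Set
IsMeander vs = All (0ℤ ≤_) (positions vs)

IsExcursion : List ℤ → Set
IsExcursion vs = IsMeander vs × endpoint vs ≡ 0ℤ

IsNMeander : List (List ℤ) → List (List ℤ) → Set
IsNMeander S w = IsNWalk S w × ∃ λ vs → Compatible vs w × IsMeander vs

IsNExcursion : List (List ℤ) → List (List ℤ) → Set
IsNExcursion S w = IsNWalk S w × ∃ λ vs → Compatible vs w × IsExcursion vs

Reachable : List (List ℤ) → ℤ → Set
Reachable w e = ∃ λ vs → Compatible vs w × IsMeander vs × endpoint vs ≡ e

IsNExcursionCount : List (List ℤ) → ℕ → ℕ → Set
IsNExcursionCount S n c =
  Σ (List (List (List ℤ))) λ L →
    Unique L
    × All (λ w → length w ≡ n × IsNExcursion S w) L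
    × (∀ w → length w ≡ n → IsNExcursion S w → w ∈ L)
    × length L ≡ c

minL : List ℤ → ℤ
minL [] = 0ℤ
minL (x ∷ xs) = foldr _⊓_ x xs

maxL : List ℤ → ℤ
maxL [] = 0ℤ
maxL (x ∷ xs) = foldr _⊔_ x xs

sumset : List ℤ → List ℤ → List ℤ
sumset s t = concatMap (λ a → map (λ x → a + x) t) s

times : ℕ → List ℤ → List ℤ
times zero s = 0ℤ ∷ []
times (suc j) s = sumset s (times j s)

bottomPrune : List ℤ → List ℤ → List ℤ
bottomPrune [] t = []
bottomPrune s@(_ ∷ _) t = filter (λ y → ¬? (y ∈? map (λ b → minL s + b) t)) s

topPrune : List ℤ → List ℤ → List ℤ
topPrune [] t = []
topPrune s@(_ ∷ _) t = filter (λ y → ¬? (y ∈? map (λ b → maxL s - b) t)) s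

typeMember : ℕ → ℕ → List ℤ → List ℤ → List ℤ → ℤ → List ℤ
typeMember n j a b c m =
  map (λ x → x + m) (topPrune (bottomPrune (sumset (times j (0ℤ ∷ + n ∷ [])) b) a) c)

TypeParams : Set
TypeParams = ℕ × ℕ × List ℤ × List ℤ × List ℤ

InType : (ℤ → Set) → TypeParams → Set
InType R (n , k , a , b , c) =
  ∃ λ (m : ℤ) → ∃ λ (j : ℕ) → k ℕ.≤ j × (∀ x → R x ⇔ (x ∈ typeMember n j a b c m))

FPS : Set
FPS = ℕ → ℤ

sumBelow : ℕ → (ℕ → ℤ) → ℤ
sumBelow zero f = 0ℤ
sumBelow (suc n) f = sumBelow n f + f n

_⊕_ : FPS → FPS → FPS
(f ⊕ g) n = f n + g n

_⊛_ : FPS → FPS → FPS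
(f ⊛ g) n = sumBelow (suc n) (λ i → f i * g (n ∸ i))

polyX : List ℤ → FPS
polyX [] n = 0ℤ
polyX (p ∷ ps) zero = p
polyX (p ∷ ps) (suc n) = polyX ps n

-- P(x, F) for P(x,y) = Σ_i p_i(x) y^i given as [p_0, p_1, …] (Horner form)
evalP : List (List ℤ) → FPS → FPS
evalP [] F n = 0ℤ
evalP (p ∷ ps) F = polyX p ⊕ (F ⊛ evalP ps F)

IsAlgebraic : FPS → Set
IsAlgebraic F =
  ∃ λ (P : List (List ℤ)) → Any (Any (_≢ 0ℤ)) P × (∀ n → evalP P F n ≡ 0ℤ)

{-# OPTIONS --safe #-}

-- Since every step s has min s ≤ 0 and the members of finitely many types have bounded gaps, the least point of every set
-- of reachable points R is bounded, and R is periodic, with a uniform period, except within a bounded distance of 0 and of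
-- L = max R. So R is described by L and by two windows of bounded width, at the bottom and at the top of R. A step s adds
-- max s to L and, as long as L is large, transforms the two windows independently of L: the N-excursions are the accepted
-- words of a deterministic automaton with one counter. Decomposing its runs by first passages gives a system
-- Y_i = γ_i + x P_i(Y) with P_i homogeneous quadratic (a constant series 1 being one of the unknowns).
--
-- The solution of the perturbed system Y_i = γ_i + x (P_i(Y) + t Y_i³) is algebraic over ℚ(x,t), because the new equations
-- express every monomial through those with all exponents at most 2: a count of coefficients produces an integer
-- polynomial relation. Divided by the largest possible power of t, it remains non-trivial at t = 0.
module Submission where

-- The quadratic system by itself gives no reduction of degree: the forms P_i may have common
-- non-trivial zeros, or vanish altogether, so that no power of an unknown need be expressible
-- through lower monomials. A term of degree 3 exceeds every other term of its equation, whatever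
-- the P_i are.
--
-- The two windows behave differently under a step s. Counted downwards from the largest point, a
-- new entry depends only on old entries at the same or a smaller depth, because no element of s
-- exceeds max s; the upper window is therefore self-contained. Counted upwards from 0, a negative
-- element of s reads entries above the window. Periodicity replaces these by entries one period
-- lower, and the period is chosen at least as large as all elements of steps in absolute value, so
-- that a single shift leads back into the window.
--
-- L is divided by a block length W that exceeds the change of L in one step: the quotient is the
-- counter, which moves by at most 1, and the remainder belongs to the finite state.

module SeriesRing where
  open import Algebra.Bundles using (CommutativeRing)
  open import Data.Nat as ℕ using (ℕ; zero; suc; z≤n; s≤s)
  import Data.Nat.Properties as ℕₚ
  open import Data.Product using (_,_)
  open import Algebra.Morphism.Structures using (module RingMorphisms)

  -- Formal power series over a commutative ring.

  module PowerSeries {c ℓ} (R : CommutativeRing c ℓ) where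
    open CommutativeRing R hiding (zero)
    open import Relation.Binary.Reasoning.Setoid setoid
    open import Algebra.Properties.Ring ring using (-0#≈0#)
    open import Algebra.Properties.CommutativeSemigroup +-commutativeSemigroup using (interchange)

    Series : Set c
    Series = ℕ → Carrier

    infix 4 _≋_
    infixl 7 _·_

    _≋_ : Series → Series → Set ℓ
    f ≋ g = ∀ n → f n ≈ g n

    tail : Series → Series
    tail f n = f (suc n)

    -- The Cauchy product in the form f · g = f(0) g + X (tail f · g). Recursion on the index of the
    -- coefficient turns the ring laws into inductions without sums over splittings of n.
    _·_ : Series → Series → Series
    (f · g) zero = f 0 * g 0
    (f · g) (suc n) = f 0 * g (suc n) + (tail f · g) n

    EqualUpTo : ℕ → Series → Series → Set ℓ
    EqualUpTo n f g = ∀ k → k ℕ.≤ n → f k ≈ g k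

    -- No coefficient beyond the n-th is read; this is what makes the iteration for the perturbed
    -- system converge.
    ·-cong-upTo : ∀ n {f f′ g g′} → EqualUpTo n f f′ → EqualUpTo n g g′ → (f · g) n ≈ (f′ · g′) n
    ·-cong-upTo zero p q = *-cong (p 0 z≤n) (q 0 z≤n)
    ·-cong-upTo (suc n) p q = +-cong (*-cong (p 0 z≤n) (q (suc n) ℕₚ.≤-refl))
      (·-cong-upTo n (λ k k≤n → p (suc k) (s≤s k≤n)) (λ k k≤n → q k (ℕₚ.m≤n⇒m≤1+n k≤n)))

    ·-EqualUpTo : ∀ {n f f′ g g′} → EqualUpTo n f f′ → EqualUpTo n g g′ → EqualUpTo n (f · g) (f′ · g′)
    ·-EqualUpTo p q k k≤n =
      ·-cong-upTo k (λ l l≤k → p l (ℕₚ.≤-trans l≤k k≤n)) (λ l l≤k → q l (ℕₚ.≤-trans l≤k k≤n))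

    ·-cong : ∀ {f f′ g g′} → f ≋ f′ → g ≋ g′ → f · g ≋ f′ · g′
    ·-cong p q n = ·-cong-upTo n (λ k _ → p k) (λ k _ → q k)

    -- The mirror image of the defining recursion, splitting off the first coefficient of the right
    -- factor; commutativity compares the two.
    ·-tailʳ : ∀ f g n → (f · g) (suc n) ≈ (f · tail g) n + f (suc n) * g 0
    ·-tailʳ f g zero = refl
    ·-tailʳ f g (suc n) = trans (+-congˡ (·-tailʳ (tail f) g n)) (sym (+-assoc _ _ _))

    ·-comm : ∀ f g → f · g ≋ g · f
    ·-comm f g zero = *-comm _ _
    ·-comm f g (suc n) = begin
      f 0 * g (suc n) + (tail f · g) n  ≈⟨ +-cong (*-comm _ _) (·-comm (tail f) g n) ⟩
      g (suc n) * f 0 + (g · tail f) n  ≈⟨ +-comm _ _ ⟩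
      (g · tail f) n + g (suc n) * f 0  ≈⟨ ·-tailʳ g f n ⟨
      (g · f) (suc n)                   ∎

    ·-distribʳ : ∀ h f g → (λ n → f n + g n) · h ≋ (λ n → (f · h) n + (g · h) n)
    ·-distribʳ h f g zero = distribʳ _ _ _
    ·-distribʳ h f g (suc n) =
      trans (+-cong (distribʳ _ _ _) (·-distribʳ h (tail f) (tail g) n)) (interchange _ _ _ _)

    ·-scaleˡ : ∀ a f g → (λ n → a * f n) · g ≋ (λ n → a * (f · g) n)
    ·-scaleˡ a f g zero = *-assoc _ _ _
    ·-scaleˡ a f g (suc n) =
      trans (+-cong (*-assoc _ _ _) (·-scaleˡ a (tail f) g n)) (sym (distribˡ _ _ _))

    ·-assoc : ∀ f g h → (f · g) · h ≋ f · (g · h)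
    ·-assoc f g h zero = *-assoc _ _ _
    ·-assoc f g h (suc n) = begin
      (f 0 * g 0) * h (suc n) + (tail (f · g) · h) n
        ≈⟨ +-cong (*-assoc _ _ _) (·-distribʳ h (λ k → f 0 * g (suc k)) (tail f · g) n) ⟩
      f 0 * (g 0 * h (suc n)) + (((λ k → f 0 * g (suc k)) · h) n + ((tail f · g) · h) n)
        ≈⟨ +-congˡ (+-cong (·-scaleˡ (f 0) (tail g) h n) (·-assoc (tail f) g h n)) ⟩
      f 0 * (g 0 * h (suc n)) + (f 0 * (tail g · h) n + (tail f · (g · h)) n)
        ≈⟨ +-assoc _ _ _ ⟨
      (f 0 * (g 0 * h (suc n)) + f 0 * (tail g · h) n) + (tail f · (g · h)) n
        ≈⟨ +-congʳ (distribˡ _ _ _) ⟨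
      f 0 * (g · h) (suc n) + (tail f · (g · h)) n ∎

    const : Carrier → Series
    const a zero = a
    const a (suc n) = 0#

    const-cong : ∀ {a b} → a ≈ b → const a ≋ const b
    const-cong p zero = p
    const-cong p (suc n) = refl

    X : Series
    X zero = 0#
    X (suc n) = const 1# n

    zero-· : ∀ g {f} → (∀ n → f n ≈ 0#) → ∀ n → (f · g) n ≈ 0#
    zero-· g z zero = trans (*-congʳ (z 0)) (zeroˡ _)
    zero-· g z (suc n) = trans (+-cong (trans (*-congʳ (z 0)) (zeroˡ _)) (zero-· g (λ n → z (suc n)) n))
      (+-identityˡ 0#)

    const-· : ∀ a g n → (const a · g) n ≈ a * g n
    const-· a g zero = refl
    const-· a g (suc n) = trans (+-congˡ (zero-· g (λ _ → refl) n)) (+-identityʳ _)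

    X-·-zero : ∀ g → (X · g) 0 ≈ 0#
    X-·-zero g = zeroˡ _

    X-·-suc : ∀ g n → (X · g) (suc n) ≈ g n
    X-·-suc g n = begin
      0# * g (suc n) + (const 1# · g) n ≈⟨ +-cong (zeroˡ _) (const-· 1# g n) ⟩
      0# + 1# * g n                     ≈⟨ +-identityˡ _ ⟩
      1# * g n                          ≈⟨ *-identityˡ _ ⟩
      g n                               ∎

    const-+ : ∀ a b → const (a + b) ≋ (λ n → const a n + const b n)
    const-+ a b zero = refl
    const-+ a b (suc n) = sym (+-identityˡ 0#)

    const-* : ∀ a b → const (a * b) ≋ const a · const b
    const-* a b zero = refl
    const-* a b (suc n) = sym (trans (const-· a (const b) (suc n)) (zeroʳ a))

    seriesRing : CommutativeRing c ℓ
    seriesRing = record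
      { Carrier = Series
      ; _≈_ = _≋_
      ; _+_ = λ f g n → f n + g n
      ; _*_ = _·_
      ; -_ = λ f n → - f n
      ; 0# = λ _ → 0#
      ; 1# = const 1#
      ; isCommutativeRing = record
        { isRing = record
          { +-isAbelianGroup = record
            { isGroup = record
              { isMonoid = record
                { isSemigroup = record
                  { isMagma = record
                    { isEquivalence = record
                      { refl = λ n → refl
                      ; sym = λ p n → sym (p n)
                      ; trans = λ p q n → trans (p n) (q n) }
                    ; ∙-cong = λ p q n → +-cong (p n) (q n) }
                  ; assoc = λ f g h n → +-assoc _ _ _ }
                ; identity = (λ f n → +-identityˡ _) , (λ f n → +-identityʳ _) }
              ; inverse = (λ f n → -‿inverseˡ _) , (λ f n → -‿inverseʳ _)
              ; ⁻¹-cong = λ p n → -‿cong (p n) }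
            ; comm = λ f g n → +-comm _ _ }
          ; *-cong = ·-cong
          ; *-assoc = ·-assoc
          ; *-identity = identityˡ , (λ f n → trans (·-comm f (const 1#) n) (identityˡ f n))
          ; distrib = (λ f g h n → trans (·-comm f _ n)
                        (trans (·-distribʳ f g h n) (+-cong (·-comm g f n) (·-comm h f n))))
                    , ·-distribʳ
          }
        ; *-comm = ·-comm } }
      where
      identityˡ : ∀ f → const 1# · f ≋ f
      identityˡ f n = trans (const-· 1# f n) (*-identityˡ _)

    const-isRingHomomorphism : RingMorphisms.IsRingHomomorphism rawRing (CommutativeRing.rawRing seriesRing) const
    const-isRingHomomorphism = record
      { isSemiringHomomorphism = record
        { isNearSemiringHomomorphism = record
          { +-isMonoidHomomorphism = record
            { isMagmaHomomorphism = record
              { isRelHomomorphism = record { cong = const-cong }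
              ; homo = const-+ }
            ; ε-homo = const-0# }
          ; *-homo = const-* }
        ; 1#-homo = λ _ → refl }
      ; -‿homo = const-‿ }
      where
      const-0# : const 0# ≋ (λ _ → 0#)
      const-0# zero = refl
      const-0# (suc n) = refl
      const-‿ : ∀ a → const (- a) ≋ (λ n → - const a n)
      const-‿ a zero = refl
      const-‿ a (suc n) = sym -0#≈0#

-- Linear dependence over the integers.

module LinearDependence where
  open import Algebra.Bundles using (CommutativeRing)
  open import Algebra.Morphism.Structures using (module RingMorphisms)
  open import Data.Nat as ℕ using (ℕ; zero; suc; s≤s)
  import Data.Nat.Properties as ℕₚ
  open import Data.Integer as ℤ using (ℤ; 0ℤ; 1ℤ)
  import Data.Integer.Properties as ℤₚ
  open import Data.Fin using (Fin; zero; suc; punchIn; combine; _↑ˡ_; _↑ʳ_)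
  open import Data.Fin.Properties using (any?)
  open import Data.Vec.Functional using (insertAt; _∷_)
  open import Data.Vec.Functional.Properties using (insertAt-lookup; insertAt-punchIn)
  open import Data.Product using (∃; _×_; _,_; proj₁; proj₂)
  open import Data.Sum using ([_,_]′)

  open import Function using (_∘_)
  open import Relation.Nullary using (¬?; yes; no)
  open import Relation.Nullary.Decidable using (decidable-stable)
  open import Relation.Binary.PropositionalEquality as ≡ using (_≡_; _≢_)

  module FinSum {c ℓ} (Ω : CommutativeRing c ℓ) where
    open CommutativeRing Ω hiding (zero)
    open import Algebra.Properties.Semiring.Sum semiring public
    open import Relation.Binary.Reasoning.Setoid setoid

    sum-zero : ∀ {n} {f : Fin n → Carrier} → (∀ i → f i ≈ 0#) → sum f ≈ 0#
    sum-zero {n} z = trans (sum-cong-≋ z) (sum-replicate-zero n)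

    sum-split : ∀ m n (f : Fin (m ℕ.+ n) → Carrier) → sum f ≈ sum (f ∘ (_↑ˡ n)) + sum (f ∘ (m ↑ʳ_))
    sum-split zero n f = sym (+-identityˡ _)
    sum-split (suc m) n f = trans (+-congˡ (sum-split m n (f ∘ suc))) (sym (+-assoc _ _ _))

    sum-combine : ∀ m n (f : Fin (m ℕ.* n) → Carrier) → sum f ≈ sum (λ i → sum (λ j → f (combine {m} i j)))
    sum-combine zero n f = refl
    sum-combine (suc m) n f =
      trans (sum-split n (m ℕ.* n) f) (+-congˡ (sum-combine m n (f ∘ (n ↑ʳ_))))

    sum-single : ∀ {n} (i : Fin n) {f : Fin n → Carrier} → (∀ j → j ≢ i → f j ≈ 0#) → sum f ≈ f i
    sum-single {suc n} i {f} z = begin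
      sum f                            ≈⟨ sum-remove {i = i} f ⟩
      f i + sum (f ∘ punchIn i)        ≈⟨ +-congˡ (sum-zero (λ j → z _ (Data.Fin.Properties.punchInᵢ≢i i j))) ⟩
      f i + 0#                         ≈⟨ +-identityʳ _ ⟩
      f i                              ∎

  module Dependence {c ℓ} (Ω : CommutativeRing c ℓ) (ι : ℤ → CommutativeRing.Carrier Ω)
    (ι-hom : RingMorphisms.IsRingHomomorphism (CommutativeRing.rawRing ℤₚ.+-*-commutativeRing) (CommutativeRing.rawRing Ω) ι) where
    open CommutativeRing Ω hiding (zero)
    open FinSum Ω
    open RingMorphisms.IsRingHomomorphism ι-hom
      using (+-homo; *-homo; 0#-homo; 1#-homo; -‿homo)
    open import Algebra.Properties.Ring ring using (-‿distribˡ-*)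
    open import Algebra.Properties.CommutativeSemigroup *-commutativeSemigroup using (x∙yz≈y∙xz)
    open import Algebra.Properties.CommutativeSemigroup +-commutativeSemigroup using (interchange)
    open import Relation.Binary.Reasoning.Setoid setoid
    private module ℤSum = FinSum ℤₚ.+-*-commutativeRing

    ι-sum : ∀ {n} (f : Fin n → ℤ) → ι (ℤSum.sum f) ≈ sum (ι ∘ f)
    ι-sum {zero} f = 0#-homo
    ι-sum {suc n} f = trans (+-homo _ _) (+-congˡ (ι-sum (f ∘ suc)))

    record Span {m} (gs : Fin m → Carrier) (u : Carrier) : Set ℓ where
      constructor span
      field
        coefficients : Fin m → ℤ
        expansion : u ≈ sum (λ i → ι (coefficients i) * gs i)
    open Span

    span-resp : ∀ {m} {gs : Fin m → Carrier} {u v} → u ≈ v → Span gs u → Span gs v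
    span-resp u≈v (span z p) = span z (trans (sym u≈v) p)

    span-0 : ∀ {m} {gs : Fin m → Carrier} → Span gs 0#
    span-0 {gs = gs} = span (λ _ → 0ℤ) (sym (sum-zero (λ i → trans (*-congʳ 0#-homo) (zeroˡ (gs i)))))

    span-+ : ∀ {m} {gs : Fin m → Carrier} {u v} → Span gs u → Span gs v → Span gs (u + v)
    span-+ {gs = gs} {u} {v} (span z p) (span z′ q) = span (λ i → z i ℤ.+ z′ i) (begin
      u + v ≈⟨ +-cong p q ⟩
      _     ≈⟨ ∑-distrib-+ (λ i → ι (z i) * gs i) (λ i → ι (z′ i) * gs i) ⟨
      _     ≈⟨ sum-cong-≋ (λ i → trans (sym (distribʳ (gs i) _ _)) (*-congʳ (sym (+-homo _ _)))) ⟩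
      _     ∎)

    span-scale : ∀ {m} {gs : Fin m → Carrier} a {u} → Span gs u → Span gs (ι a * u)
    span-scale {gs = gs} a {u} (span z p) = span (λ i → a ℤ.* z i) (begin
      ι a * u ≈⟨ *-congˡ p ⟩
      _       ≈⟨ *-distribˡ-sum (ι a) (λ i → ι (z i) * gs i) ⟩
      _       ≈⟨ sum-cong-≋ (λ i → trans (sym (*-assoc _ _ (gs i))) (*-congʳ (sym (*-homo _ _)))) ⟩
      _       ∎)

    span-drop : ∀ {m} {gs : Fin (suc m) → Carrier} {u} → Span (gs ∘ suc) u → Span gs u
    span-drop {gs = gs} (span z p) = span (0ℤ ∷ z)
      (trans p (trans (sym (+-identityˡ _)) (+-congʳ (sym (trans (*-congʳ 0#-homo) (zeroˡ (gs zero)))))))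

    span-gen : ∀ {m} {gs : Fin m → Carrier} i → Span gs (gs i)
    span-gen {gs = gs} zero = span (1ℤ ∷ λ _ → 0ℤ) (sym (trans
      (+-cong (trans (*-congʳ 1#-homo) (*-identityˡ _))
              (sum-zero (λ i → trans (*-congʳ 0#-homo) (zeroˡ (gs (suc i))))))
      (+-identityʳ _)))
    span-gen (suc i) = span-drop (span-gen i)

    -- By fraction-free Gaussian elimination.
    dependence : ∀ {m n} (gs : Fin m → Carrier) (us : Fin n → Carrier) → m ℕ.< n →
      (∀ j → Span gs (us j)) →
      ∃ λ (z : Fin n → ℤ) → (∃ λ j → z j ≢ 0ℤ) × sum (λ j → ι (z j) * us j) ≈ 0#
    dependence {zero} {suc n} gs us _ h =
      (λ _ → 1ℤ) , (zero , λ ()) , sum-zero (λ j → trans (*-congˡ (expansion (h j))) (zeroʳ (ι 1ℤ)))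
    dependence {suc m} {suc n} gs us (s≤s m<n) h
      with any? (λ j → ¬? (coefficients (h j) zero ℤ.≟ 0ℤ))
    -- The first generator occurs in no expansion, so it is dropped and all the elements are kept.
    ... | no all-zero = dependence (gs ∘ suc) us (ℕₚ.m<n⇒m<1+n m<n) λ j →
      span (coefficients (h j) ∘ suc) (trans (expansion (h j)) (trans
        (+-congʳ (trans (*-congʳ (trans (reflexive (≡.cong ι (a-zero j))) 0#-homo)) (zeroˡ _))) (+-identityˡ _)))
      where
      a-zero : ∀ j → coefficients (h j) zero ≡ 0ℤ
      a-zero j = decidable-stable (_ ℤ.≟ _) (λ ≢0 → all-zero (j , ≢0))
    ... | yes (p , ap≢0) = z , (punchIn p j₀ , z≢0) , z-rel
      where
      a : Fin (suc n) → ℤ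
      a j = coefficients (h j) zero

      b : Fin (suc n) → Fin m → ℤ
      b j = coefficients (h j) ∘ suc

      rest : Fin (suc n) → Carrier
      rest j = sum (λ i → ι (b j i) * gs (suc i))

      -- Cross-multiplication with the pivot element `us p` cancels the first generator without
      -- division.
      us′ : Fin n → Carrier
      us′ j = ι (a p) * us (punchIn p j) + ι (ℤ.- a (punchIn p j)) * us p

      cancel : ∀ j → ι (a p) * us j + ι (ℤ.- a j) * us p ≈ ι (a p) * rest j + ι (ℤ.- a j) * rest p
      cancel j = begin
        ι (a p) * us j + ι (ℤ.- a j) * us p
          ≈⟨ +-cong (*-congˡ (expansion (h j))) (*-congˡ (expansion (h p))) ⟩
        ι (a p) * (ι (a j) * gs zero + rest j) + ι (ℤ.- a j) * (ι (a p) * gs zero + rest p)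
          ≈⟨ +-cong (distribˡ _ _ _) (distribˡ _ _ _) ⟩
        (ι (a p) * (ι (a j) * gs zero) + ι (a p) * rest j) + (ι (ℤ.- a j) * (ι (a p) * gs zero) + ι (ℤ.- a j) * rest p)
          ≈⟨ interchange _ _ _ _ ⟩
        (ι (a p) * (ι (a j) * gs zero) + ι (ℤ.- a j) * (ι (a p) * gs zero)) + (ι (a p) * rest j + ι (ℤ.- a j) * rest p)
          ≈⟨ +-congʳ opposite ⟩
        0# + (ι (a p) * rest j + ι (ℤ.- a j) * rest p)
          ≈⟨ +-identityˡ _ ⟩
        ι (a p) * rest j + ι (ℤ.- a j) * rest p ∎
        where
        opposite : ι (a p) * (ι (a j) * gs zero) + ι (ℤ.- a j) * (ι (a p) * gs zero) ≈ 0#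
        opposite = begin
          ι (a p) * (ι (a j) * gs zero) + ι (ℤ.- a j) * (ι (a p) * gs zero)
            ≈⟨ +-cong (x∙yz≈y∙xz _ _ _) (trans (*-congʳ (-‿homo (a j))) (sym (-‿distribˡ-* _ _))) ⟩
          ι (a j) * (ι (a p) * gs zero) - ι (a j) * (ι (a p) * gs zero)
            ≈⟨ -‿inverseʳ _ ⟩
          0# ∎

      us′-span : ∀ j → Span (gs ∘ suc) (us′ j)
      us′-span j = span-resp (sym (cancel (punchIn p j)))
        (span-+ (span-scale (a p) (span (b (punchIn p j)) refl)) (span-scale _ (span (b p) refl)))

      ih : ∃ λ (z : Fin n → ℤ) → (∃ λ j → z j ≢ 0ℤ) × sum (λ j → ι (z j) * us′ j) ≈ 0#
      ih = dependence (gs ∘ suc) us′ m<n us′-span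

      z′ : Fin n → ℤ
      z′ = proj₁ ih

      j₀ : Fin n
      j₀ = proj₁ (proj₁ (proj₂ ih))

      others : Fin n → ℤ
      others j = z′ j ℤ.* a p

      pivot : Fin n → ℤ
      pivot j = z′ j ℤ.* (ℤ.- a (punchIn p j))

      -- The relation between the `us′` is expanded: `us p` collects the cross terms, and every
      -- other coefficient is multiplied by `a p`, so that a non-zero one stays non-zero.
      z : Fin (suc n) → ℤ
      z = insertAt others p (ℤSum.sum pivot)

      z≢0 : z (punchIn p j₀) ≢ 0ℤ
      z≢0 eq = [ proj₂ (proj₁ (proj₂ ih)) , ap≢0 ]′
        (ℤₚ.i*j≡0⇒i≡0∨j≡0 (z′ j₀) (≡.trans (≡.sym (insertAt-punchIn others p _ j₀)) eq))

      z-rel : sum (λ j → ι (z j) * us j) ≈ 0#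
      z-rel = begin
        sum (λ j → ι (z j) * us j)
          ≈⟨ sum-remove {i = p} (λ j → ι (z j) * us j) ⟩
        ι (z p) * us p + sum (λ j → ι (z (punchIn p j)) * us (punchIn p j))
          ≡⟨ ≡.cong₂ _+_ (≡.cong (λ w → ι w * us p) (insertAt-lookup others p _))
               (sum-cong-≗ (λ j → ≡.cong (λ w → ι w * us (punchIn p j)) (insertAt-punchIn others p _ j))) ⟩
        ι (ℤSum.sum pivot) * us p + sum (λ j → ι (others j) * us (punchIn p j))
          ≈⟨ +-congʳ (trans (*-congʳ (ι-sum pivot)) (*-distribʳ-sum (us p) (ι ∘ pivot))) ⟩
        sum (λ j → ι (pivot j) * us p) + sum (λ j → ι (others j) * us (punchIn p j))
          ≈⟨ ∑-distrib-+ (λ j → ι (pivot j) * us p) (λ j → ι (others j) * us (punchIn p j)) ⟨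
        sum (λ j → ι (pivot j) * us p + ι (others j) * us (punchIn p j))
          ≈⟨ sum-cong-≋ regroup ⟩
        sum (λ j → ι (z′ j) * us′ j)
          ≈⟨ proj₂ (proj₂ ih) ⟩
        0# ∎
        where
        regroup : ∀ j → ι (pivot j) * us p + ι (others j) * us (punchIn p j) ≈ ι (z′ j) * us′ j
        regroup j = begin
          ι (pivot j) * us p + ι (others j) * us (punchIn p j)
            ≈⟨ +-cong (trans (*-congʳ (*-homo _ _)) (*-assoc _ _ _)) (trans (*-congʳ (*-homo _ _)) (*-assoc _ _ _)) ⟩
          ι (z′ j) * (ι (ℤ.- a (punchIn p j)) * us p) + ι (z′ j) * (ι (a p) * us (punchIn p j))
            ≈⟨ +-comm _ _ ⟩
          ι (z′ j) * (ι (a p) * us (punchIn p j)) + ι (z′ j) * (ι (ℤ.- a (punchIn p j)) * us p)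
            ≈⟨ distribˡ _ _ _ ⟨
          ι (z′ j) * us′ j ∎

-- Elimination in a system with a cubic perturbation.

module CubicElimination where
  open LinearDependence
  open import Level using (_⊔_)
  open import Algebra.Bundles using (CommutativeRing)
  open import Algebra.Morphism.Structures using (module RingMorphisms)
  open import Data.Nat as ℕ using (ℕ; zero; suc; z≤n; s≤s)
  import Data.Nat.Properties as ℕₚ
  open import Data.Nat.Tactic.RingSolver using (solve-∀)
  open import Data.Integer using (ℤ; 0ℤ; 1ℤ; -1ℤ)
  import Data.Integer.Properties as ℤₚ
  open import Data.Fin using (Fin; zero; suc; toℕ; fromℕ<; combine; remQuot)
  open import Data.Fin.Properties using (remQuot-combine; combine-remQuot; toℕ<n; toℕ-fromℕ<)
  open import Data.List as List using (List; []; _∷_; length; cartesianProductWith)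
  open import Data.List.Membership.Propositional using (_∈_)
  open import Data.List.Membership.Propositional.Properties using (∈-cartesianProductWith⁺)
  open import Data.List.Relation.Unary.Any as Any using (here; there)
  open import Data.List.Relation.Unary.Any.Properties using (lookup-index)
  open import Data.Vec as Vec using (Vec; []; _∷_; updateAt)
  open import Data.Product using (∃; _×_; _,_; proj₁; proj₂)
  open import Data.Sum using (_⊎_; inj₁; inj₂)
  open import Function using (_∘_)
  open import Relation.Binary.PropositionalEquality as ≡ using (_≡_; _≢_)

  pack : ∀ {A B C} → Fin A × Fin B × Fin C → Fin (A ℕ.* (B ℕ.* C))
  pack (i , j , k) = combine i (combine j k)

  unpack : ∀ A B C → Fin (A ℕ.* (B ℕ.* C)) → Fin A × Fin B × Fin C
  unpack A B C r = proj₁ (remQuot {A} (B ℕ.* C) r) , remQuot {B} C (proj₂ (remQuot {A} (B ℕ.* C) r))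

  unpack-pack : ∀ {A B C} (p : Fin A × Fin B × Fin C) → unpack A B C (pack p) ≡ p
  unpack-pack (i , j , k) = ≡.trans
    (≡.cong (λ p → proj₁ p , remQuot _ (proj₂ p)) (remQuot-combine i (combine j k)))
    (≡.cong (i ,_) (remQuot-combine j k))

  pack-unpack : ∀ A B C r → pack (unpack A B C r) ≡ r
  pack-unpack A B C r = ≡.trans
    (≡.cong (combine (proj₁ (remQuot {A} (B ℕ.* C) r))) (combine-remQuot {B} C (proj₂ (remQuot {A} (B ℕ.* C) r))))
    (combine-remQuot {A} (B ℕ.* C) r)

  bump : ∀ {d} → Fin d → Vec ℕ d → Vec ℕ d
  bump i e = updateAt e i suc

  sum-bump : ∀ {d} (i : Fin d) e → Vec.sum (bump i e) ≡ suc (Vec.sum e)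
  sum-bump zero (n ∷ e) = ≡.refl
  sum-bump (suc i) (n ∷ e) = ≡.trans (≡.cong (n ℕ.+_) (sum-bump i e)) (ℕₚ.+-suc n _)

  smallExponents : ∀ d → List (Vec ℕ d)
  smallExponents zero = [] ∷ []
  smallExponents (suc d) = cartesianProductWith _∷_ (0 ∷ 1 ∷ 2 ∷ []) (smallExponents d)

  small-or-cube : ∀ {d} (e : Vec ℕ d) →
    (e ∈ smallExponents d) ⊎ ∃ λ i → ∃ λ e′ → e ≡ bump i (bump i (bump i e′))
  small-or-cube [] = inj₁ (here ≡.refl)
  small-or-cube (suc (suc (suc n)) ∷ e) = inj₂ (zero , n ∷ e , ≡.refl)
  small-or-cube (n ∷ e) with small-or-cube e
  small-or-cube (n ∷ e) | inj₂ (i , e′ , ≡.refl) = inj₂ (suc i , n ∷ e′ , ≡.refl)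
  small-or-cube (0 ∷ e) | inj₁ e∈ = inj₁ (∈-cartesianProductWith⁺ _∷_ {0 ∷ 1 ∷ 2 ∷ []} (here ≡.refl) e∈)
  small-or-cube (1 ∷ e) | inj₁ e∈ = inj₁ (∈-cartesianProductWith⁺ _∷_ {0 ∷ 1 ∷ 2 ∷ []} (there (here ≡.refl)) e∈)
  small-or-cube (2 ∷ e) | inj₁ e∈ = inj₁ (∈-cartesianProductWith⁺ _∷_ {0 ∷ 1 ∷ 2 ∷ []} (there (there (here ≡.refl))) e∈)
  small-or-cube (suc (suc (suc n)) ∷ e) | inj₁ _ = inj₂ (zero , n ∷ e , ≡.refl)

  module ListSum {c ℓ} (Ω : CommutativeRing c ℓ) where
    open CommutativeRing Ω hiding (zero)

    lsum : ∀ {a} {A : Set a} → (A → Carrier) → List A → Carrier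
    lsum f [] = 0#
    lsum f (x ∷ xs) = f x + lsum f xs

    quadratic : ∀ {d} → (Fin d → Carrier) → List (Fin d × Fin d) → Carrier
    quadratic y = lsum (λ p → y (proj₁ p) * y (proj₂ p))

  module Monomials {c ℓ} (Ω : CommutativeRing c ℓ) where
    open CommutativeRing Ω hiding (zero)
    open import Algebra.Properties.Semiring.Exp semiring using (_^_)
    open import Algebra.Properties.CommutativeSemigroup *-commutativeSemigroup using (x∙yz≈y∙xz)

    mono : ∀ {d} → (Fin d → Carrier) → Vec ℕ d → Carrier
    mono y [] = 1#
    mono y (n ∷ e) = y zero ^ n * mono (y ∘ suc) e

    mono-bump : ∀ {d} (y : Fin d → Carrier) i e → mono y (bump i e) ≈ y i * mono y e
    mono-bump y zero (n ∷ e) = *-assoc _ _ _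
    mono-bump y (suc i) (n ∷ e) = trans (*-congˡ (mono-bump (y ∘ suc) i e)) (x∙yz≈y∙xz _ _ _)

    power : ∀ {d} → Fin d → ℕ → Vec ℕ d
    power i zero = Vec.replicate _ 0
    power i (suc k) = bump i (power i k)

    sum-power : ∀ {d} (i : Fin d) k → Vec.sum (power i k) ≡ k
    sum-power {d} i zero = zeros d
      where
      zeros : ∀ d → Vec.sum (Vec.replicate d 0) ≡ 0
      zeros zero = ≡.refl
      zeros (suc d) = zeros d
    sum-power i (suc k) = ≡.trans (sum-bump i (power i k)) (≡.cong suc (sum-power i k))

    mono-power : ∀ {d} (y : Fin d → Carrier) i k → mono y (power i k) ≈ y i ^ k
    mono-power y i zero = zeros y
      where
      zeros : ∀ {d} (y : Fin d → Carrier) → mono y (Vec.replicate d 0) ≈ 1#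
      zeros {zero} y = refl
      zeros {suc d} y = trans (*-identityˡ _) (zeros (y ∘ suc))
    mono-power y i (suc k) = trans (mono-bump y i (power i k)) (*-congˡ (mono-power y i k))

  module Elimination {c ℓ} (Ω : CommutativeRing c ℓ) (ι : ℤ → CommutativeRing.Carrier Ω)
    (ι-hom : RingMorphisms.IsRingHomomorphism (CommutativeRing.rawRing ℤₚ.+-*-commutativeRing) (CommutativeRing.rawRing Ω) ι)
    (x t : CommutativeRing.Carrier Ω) where
    open CommutativeRing Ω hiding (zero)
    open FinSum Ω
    open ListSum Ω
    open Monomials Ω
    open Dependence Ω ι ι-hom
    open RingMorphisms.IsRingHomomorphism ι-hom using (1#-homo; -‿homo)
    open import Algebra.Properties.Semiring.Exp semiring using (_^_; ^-homo-*)
    open import Algebra.Properties.Ring ring using (-1*x≈-x)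
    open import Relation.Binary.Reasoning.Setoid setoid
    open import Algebra.Solver.Ring.NaturalCoefficients.Default commutativeSemiring
      using (solve; _:=_; _:+_; _:*_)

    module _ {d : ℕ} (y : Fin d → Carrier) where

      -- The integer span of the generators `gen`, given inductively: shifting and widening become
      -- plain inductions without renumbering, and coefficients appear only in `bounded⇒span`.
      data Bounded (γ : ℕ) : Carrier → Set (c ⊔ ℓ) where
        gen   : ∀ {a b e} → a ℕ.< γ → b ℕ.< γ → e ∈ smallExponents d → Bounded γ (x ^ a * (t ^ b * mono y e))
        nil   : Bounded γ 0#
        add   : ∀ {u v} → Bounded γ u → Bounded γ v → Bounded γ (u + v)
        scale : ∀ a {u} → Bounded γ u → Bounded γ (ι a * u)
        resp  : ∀ {u v} → u ≈ v → Bounded γ u → Bounded γ v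

      negate : ∀ {γ u} → Bounded γ u → Bounded γ (- u)
      negate {u = u} p = resp (trans (*-congʳ (trans (-‿homo 1ℤ) (-‿cong 1#-homo))) (-1*x≈-x u)) (scale -1ℤ p)

      widen : ∀ {γ δ u} → γ ℕ.≤ δ → Bounded γ u → Bounded δ u
      widen γ≤δ (gen a<γ b<γ e∈) = gen (ℕₚ.<-≤-trans a<γ γ≤δ) (ℕₚ.<-≤-trans b<γ γ≤δ) e∈
      widen γ≤δ nil = nil
      widen γ≤δ (add p q) = add (widen γ≤δ p) (widen γ≤δ q)
      widen γ≤δ (scale a p) = scale a (widen γ≤δ p)
      widen γ≤δ (resp u≈v p) = resp u≈v (widen γ≤δ p)

      shift : ∀ {A γ a b u} → a ℕ.≤ A → b ℕ.≤ A → Bounded γ u → Bounded (A ℕ.+ γ) (x ^ a * (t ^ b * u))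
      shift {a = a} {b} a≤A b≤A (gen {a′} {b′} {e} a<γ b<γ e∈) = resp
        (trans (*-cong (^-homo-* x a a′) (*-congʳ (^-homo-* t b b′)))
          (solve 5 (λ p q r s m → ((p :* q) :* ((r :* s) :* m)) := (p :* (r :* (q :* (s :* m))))) refl
            (x ^ a) (x ^ a′) (t ^ b) (t ^ b′) (mono y e)))
        (gen (ℕₚ.+-mono-≤-< a≤A a<γ) (ℕₚ.+-mono-≤-< b≤A b<γ) e∈)
      shift {a = a} {b} a≤A b≤A nil = resp (sym (trans (*-congˡ (zeroʳ _)) (zeroʳ _))) nil
      shift {a = a} {b} a≤A b≤A (add {u} {v} p q) = resp
        (solve 4 (λ p q u v → ((p :* (q :* u)) :+ (p :* (q :* v))) := (p :* (q :* (u :+ v)))) refl (x ^ a) (t ^ b) u v)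
        (add (shift a≤A b≤A p) (shift a≤A b≤A q))
      shift {a = a} {b} a≤A b≤A (scale z {u} p) = resp
        (solve 4 (λ p q z u → (z :* (p :* (q :* u))) := (p :* (q :* (z :* u)))) refl (x ^ a) (t ^ b) (ι z) u)
        (scale z (shift a≤A b≤A p))
      shift a≤A b≤A (resp u≈v p) = resp (*-congˡ (*-congˡ u≈v)) (shift a≤A b≤A p)

      shift-x : ∀ {γ u} → Bounded γ u → Bounded (suc γ) (x * u)
      shift-x {u = u} p = resp (*-cong (*-identityʳ x) (*-identityˡ u)) (shift {1} {a = 1} {0} (s≤s z≤n) z≤n p)

      shift-xt : ∀ n {γ u} → Bounded γ u → Bounded (n ℕ.+ γ) ((x * t) ^ n * u)
      shift-xt zero p = resp (sym (*-identityˡ _)) p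
      shift-xt (suc n) {u = u} p = resp
        (trans (*-cong (*-identityʳ x) (*-congʳ (*-identityʳ t)))
          (solve 4 (λ x t w u → (x :* (t :* (w :* u))) := (((x :* t) :* w) :* u)) refl x t ((x * t) ^ n) u))
        (shift {1} {a = 1} {1} (s≤s z≤n) (s≤s z≤n) (shift-xt n p))

      generator : ∀ {γ} → Fin γ × Fin γ × Fin (length (smallExponents d)) → Carrier
      generator (a , b , e) = x ^ toℕ a * (t ^ toℕ b * mono y (List.lookup (smallExponents d) e))

      generators : ∀ γ → Fin (γ ℕ.* (γ ℕ.* length (smallExponents d))) → Carrier
      generators γ i = generator (unpack γ γ _ i)

      bounded⇒span : ∀ {γ u} → Bounded γ u → Span (generators γ) u
      bounded⇒span {γ} (gen {a} {b} {e} a<γ b<γ e∈) =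
        span-resp (reflexive (≡.trans (≡.cong generator (unpack-pack i)) eq)) (span-gen (pack i))
        where
        i = fromℕ< a<γ , fromℕ< b<γ , Any.index e∈
        eq : generator i ≡ x ^ a * (t ^ b * mono y e)
        eq rewrite toℕ-fromℕ< a<γ | toℕ-fromℕ< b<γ | ≡.sym (lookup-index e∈) = ≡.refl
      bounded⇒span nil = span-0
      bounded⇒span (add p q) = span-+ (bounded⇒span p) (bounded⇒span q)
      bounded⇒span (scale a p) = span-scale a (bounded⇒span p)
      bounded⇒span (resp u≈v p) = span-resp u≈v (bounded⇒span p)

      module _ (γ₀ : Fin d → ℤ) (P : Fin d → List (Fin d × Fin d))
        (system : ∀ i → y i ≈ ι (γ₀ i) + x * (quadratic y (P i) + t * (y i * (y i * y i)))) where

        -- The perturbation makes the cubes the terms of highest degree, so that they can be traded for terms of lower degree.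
        cube-reduction : ∀ i w m → (x * t * w) * (y i * (y i * (y i * m)))
          ≈ w * (y i * m) + - (ι (γ₀ i) * (w * m) + x * (w * (quadratic y (P i) * m)))
        cube-reduction i w m = sym (begin
          w * (y i * m) + - rest          ≈⟨ +-congʳ (trans (*-congˡ (*-congʳ (system i))) expand) ⟩
          (target + rest) + - rest        ≈⟨ +-assoc _ _ _ ⟩
          target + (rest + - rest)        ≈⟨ +-congˡ (-‿inverseʳ rest) ⟩
          target + 0#                     ≈⟨ +-identityʳ target ⟩
          target                          ∎)
          where
          q = quadratic y (P i)
          rest = ι (γ₀ i) * (w * m) + x * (w * (q * m))
          target = (x * t * w) * (y i * (y i * (y i * m)))
          expand : w * ((ι (γ₀ i) + x * (q + t * (y i * (y i * y i)))) * m) ≈ target + rest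
          expand = solve 7 (λ w g x q t y m →
            (w :* ((g :+ (x :* (q :+ (t :* (y :* (y :* y)))))) :* m))
            := ((((x :* t) :* w) :* (y :* (y :* (y :* m)))) :+ ((g :* (w :* m)) :+ (x :* (w :* (q :* m)))))) refl
            w (ι (γ₀ i)) x q t (y i) m

        -- Induction on D. A cube costs one factor x t, and `cube-reduction` leaves monomials of
        -- degree lower by 2, 3 and 1, so D factors suffice in degree at most D. The bound on the
        -- exponents of x and t grows by at most 2 in each round, whence 2D + 1.
        reduce : ∀ D e → Vec.sum e ℕ.≤ D → Bounded (suc (D ℕ.+ D)) ((x * t) ^ D * mono y e)
        reduce D e e≤D with small-or-cube e
        ... | inj₁ e∈ = widen (ℕₚ.≤-trans (ℕₚ.≤-reflexive (ℕₚ.+-comm D 1)) (s≤s (ℕₚ.m≤m+n D D)))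
          (shift-xt D (resp (trans (*-identityˡ _) (*-identityˡ _)) (gen {a = 0} {0} (s≤s z≤n) (s≤s z≤n) e∈)))
        reduce D e e≤D | inj₂ (i , e′ , ≡.refl)
          rewrite sum-bump i (bump i (bump i e′)) | sum-bump i (bump i e′) | sum-bump i e′
          with D | e≤D
        ... | suc D′ | s≤s e≤D′ = resp
          (sym (trans (*-congˡ (trans (mono-bump y i (bump i (bump i e′))) (*-congˡ (trans (mono-bump y i (bump i e′)) (*-congˡ (mono-bump y i e′))))))
            (cube-reduction i w (mono y e′))))
          (widen (s≤s (s≤s (ℕₚ.+-monoʳ-≤ D′ (ℕₚ.n≤1+n D′))))
            (add (widen (ℕₚ.n≤1+n _) (resp (*-congˡ (mono-bump y i e′)) (reduce D′ (bump i e′) (≤-bump i e′ sum≤′))))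
              (negate (add
                (widen (ℕₚ.n≤1+n _) (scale (γ₀ i) (reduce D′ e′ (ℕₚ.≤-trans (ℕₚ.n≤1+n _) sum≤′))))
                (shift-x (products (P i)))))))
          where
          w = (x * t) ^ D′

          ≤-bump : ∀ j f {n} → suc (Vec.sum f) ℕ.≤ n → Vec.sum (bump j f) ℕ.≤ n
          ≤-bump j f p = ℕₚ.≤-trans (ℕₚ.≤-reflexive (sum-bump j f)) p

          sum≤′ : suc (Vec.sum e′) ℕ.≤ D′
          sum≤′ = ℕₚ.≤-trans (ℕₚ.n≤1+n _) e≤D′

          products : ∀ Q → Bounded (suc (D′ ℕ.+ D′)) (w * (quadratic y Q * mono y e′))
          products [] = resp (sym (trans (*-congˡ (zeroˡ _)) (zeroʳ _))) nil
          products ((j , k) ∷ Q) = resp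
            (trans (+-congʳ (*-congˡ (trans (mono-bump y j (bump k e′)) (*-congˡ (mono-bump y k e′)))))
              (solve 5 (λ w j k q m → ((w :* (j :* (k :* m))) :+ (w :* (q :* m))) := (w :* (((j :* k) :+ q) :* m))) refl
                w (y j) (y k) (quadratic y Q) (mono y e′)))
            (add (reduce D′ (bump j (bump k e′))
                   (≤-bump j (bump k e′) (ℕₚ.≤-trans (s≤s (ℕₚ.≤-reflexive (sum-bump k e′))) e≤D′)))
                 (products Q))

        module _ (x-regular : ∀ u → x * u ≈ 0# → u ≈ 0#) (t-regular : ∀ u → t * u ≈ 0# → u ≈ 0#) (i : Fin d) where

          polynomial : ∀ {K A} → (Fin K → Fin A → ℤ) → Carrier
          polynomial z = sum (λ k → sum (λ a → ι (z k a) * (x ^ toℕ a * y i ^ toℕ k)))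

          -- The A²(K+1) products u b k a lie in the span of (2A)²M generators, where A = 2K+1; they are dependent if K = 4M.
          annihilator : ∃ λ A → ∃ λ K → ∃ λ (z : Fin A → Fin K → Fin A → ℤ) →
            (∃ λ b → ∃ λ k → ∃ λ a → z b k a ≢ 0ℤ) × sum (λ b → t ^ toℕ b * polynomial (z b)) ≈ 0#
          annihilator = A , suc K , z , (proj₁ bka , proj₁ (proj₂ bka) , proj₂ (proj₂ bka) , z≢0) ,
            -- All products carry the factor (x t)^K that the reduction of degrees up to K requires;
            -- it is taken out of the relation and cancelled.
            xt-regular K _ (trans (sym factor) (trans (sym unflatten) (proj₂ (proj₂ relation))))
            where
            M = length (smallExponents d)
            K = 4 ℕ.* M
            A = suc (K ℕ.+ K)

            u : Fin A → Fin (suc K) → Fin A → Carrier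
            u b k a = x ^ toℕ a * (t ^ toℕ b * ((x * t) ^ K * y i ^ toℕ k))

            uncurried : Fin A × Fin (suc K) × Fin A → Carrier
            uncurried (b , k , a) = u b k a

            u′ : Fin (A ℕ.* (suc K ℕ.* A)) → Carrier
            u′ j = uncurried (unpack A (suc K) A j)

            u-bounded : ∀ b k a → Bounded (A ℕ.+ A) (u b k a)
            u-bounded b k a = shift (ℕₚ.<⇒≤ (toℕ<n a)) (ℕₚ.<⇒≤ (toℕ<n b))
              (resp (*-congˡ (mono-power y i (toℕ k)))
                (reduce K (power i (toℕ k)) (ℕₚ.≤-trans (ℕₚ.≤-reflexive (sum-power i (toℕ k))) (ℕₚ.≤-pred (toℕ<n k)))))

            enough : (A ℕ.+ A) ℕ.* ((A ℕ.+ A) ℕ.* M) ℕ.< A ℕ.* (suc K ℕ.* A)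
            enough = ℕₚ.<-≤-trans (ℕₚ.m<n+m _ {A ℕ.* A} (s≤s z≤n)) (ℕₚ.≤-reflexive
              (count A M))
              where
              count : ∀ A M → A ℕ.* A ℕ.+ (A ℕ.+ A) ℕ.* ((A ℕ.+ A) ℕ.* M) ≡ A ℕ.* (suc (4 ℕ.* M) ℕ.* A)
              count = solve-∀

            relation = dependence (generators (A ℕ.+ A)) u′ enough
              (λ j → bounded⇒span (let b , k , a = unpack A (suc K) A j in u-bounded b k a))

            z : Fin A → Fin (suc K) → Fin A → ℤ
            z b k a = proj₁ relation (pack (b , k , a))

            bka = unpack A (suc K) A (proj₁ (proj₁ (proj₂ relation)))

            z≢0 : z (proj₁ bka) (proj₁ (proj₂ bka)) (proj₂ (proj₂ bka)) ≢ 0ℤ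
            z≢0 eq = proj₂ (proj₁ (proj₂ relation))
              (≡.trans (≡.cong (proj₁ relation) (≡.sym (pack-unpack A (suc K) A _))) eq)

            unflatten : sum (λ j → ι (proj₁ relation j) * u′ j)
              ≈ sum (λ b → sum (λ k → sum (λ a → ι (z b k a) * u b k a)))
            unflatten = trans (sum-combine A (suc K ℕ.* A) (λ j → ι (proj₁ relation j) * u′ j)) (sum-cong-≋ λ b →
              trans (sum-combine (suc K) A (λ r → ι (proj₁ relation (combine b r)) * u′ (combine b r))) (sum-cong-≋ λ k → sum-cong-≋ λ a →
                *-congˡ {ι (z b k a)} (reflexive (≡.cong uncurried (unpack-pack (b , k , a))))))

            factor : sum (λ b → sum (λ k → sum (λ a → ι (z b k a) * u b k a)))
              ≈ (x * t) ^ K * sum (λ b → t ^ toℕ b * polynomial (z b))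
            factor = begin
              sum (λ b → sum (λ k → sum (λ a → ι (z b k a) * u b k a)))
                ≈⟨ sum-cong-≋ (λ b → sum-cong-≋ λ k → trans
                     (sum-cong-≋ λ a → solve 5 (λ z x t w y → (z :* (x :* (t :* (w :* y)))) := ((w :* t) :* (z :* (x :* y)))) refl
                       (ι (z b k a)) (x ^ toℕ a) (t ^ toℕ b) ((x * t) ^ K) (y i ^ toℕ k))
                     (sym (*-distribˡ-sum ((x * t) ^ K * t ^ toℕ b) (λ a → ι (z b k a) * (x ^ toℕ a * y i ^ toℕ k))))) ⟩
                sum (λ b → sum (λ k → ((x * t) ^ K * t ^ toℕ b) * sum (λ a → ι (z b k a) * (x ^ toℕ a * y i ^ toℕ k))))
                ≈⟨ sum-cong-≋ (λ b → sym (*-distribˡ-sum ((x * t) ^ K * t ^ toℕ b) (λ k → sum (λ a → ι (z b k a) * (x ^ toℕ a * y i ^ toℕ k))))) ⟩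
              sum (λ b → ((x * t) ^ K * t ^ toℕ b) * polynomial (z b))
                ≈⟨ sum-cong-≋ {A} (λ b → *-assoc ((x * t) ^ K) (t ^ toℕ b) (polynomial (z b))) ⟩
              sum (λ b → (x * t) ^ K * (t ^ toℕ b * polynomial (z b)))
                ≈⟨ *-distribˡ-sum ((x * t) ^ K) (λ b → t ^ toℕ b * polynomial (z b)) ⟨
              (x * t) ^ K * sum (λ b → t ^ toℕ b * polynomial (z b)) ∎

            xt-regular : ∀ n v → (x * t) ^ n * v ≈ 0# → v ≈ 0#
            xt-regular zero v p = trans (sym (*-identityˡ v)) p
            xt-regular (suc n) v p = xt-regular n v (t-regular _ (x-regular _ (trans
              (solve 4 (λ x t w v → (x :* (t :* (w :* v))) := (((x :* t) :* w) :* v)) refl x t ((x * t) ^ n) v) p)))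

-- Algebraicity of the solutions of quadratic systems.

module QuadraticSystems where
  open import Defs using (FPS; _⊛_; sumBelow; polyX; evalP; IsAlgebraic)
  open SeriesRing
  open LinearDependence
  open CubicElimination
  open import Algebra.Bundles using (CommutativeRing)
  open import Algebra.Morphism.Structures using (module RingMorphisms)
  open import Algebra.Morphism.Construct.Composition using (isRingHomomorphism)
  open import Data.Nat as ℕ using (ℕ; zero; suc; s≤s)
  import Data.Nat.Properties as ℕₚ
  open import Data.Integer as ℤ using (ℤ; 0ℤ; _+_; _*_)
  import Data.Integer.Properties as ℤₚ
  open import Data.Fin using (Fin; zero; suc; toℕ)
  open import Data.Fin.Properties using (any?)
  open import Data.List as List using (List; []; _∷_)
  open import Data.List.Relation.Unary.Any using (Any)
  open import Data.List.Relation.Unary.Any.Properties using (tabulate⁺)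
  open import Data.Product using (∃; _×_; _,_)
  open import Function using (_∘_)
  open import Relation.Nullary using (¬?; yes; no; contradiction)
  open import Relation.Nullary.Decidable using (decidable-stable)
  open import Relation.Binary.PropositionalEquality using (_≡_; _≢_; refl; sym; trans; cong; cong₂; module ≡-Reasoning)

  module 𝕊 = PowerSeries ℤₚ.+-*-commutativeRing
  module 𝔹 = PowerSeries 𝕊.seriesRing
  module 𝕊R = CommutativeRing 𝕊.seriesRing
  module 𝔹R = CommutativeRing 𝔹.seriesRing
  module 𝕊Σ = FinSum 𝕊.seriesRing
  module 𝔹Σ = FinSum 𝔹.seriesRing
  module 𝕊L = ListSum 𝕊.seriesRing
  module 𝔹L = ListSum 𝔹.seriesRing
  open import Algebra.Properties.Semiring.Exp 𝕊R.semiring as 𝕊^ using ()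
  open import Algebra.Properties.Semiring.Exp 𝔹R.semiring as 𝔹^ using ()

  ⊛≋· : ∀ f g → f ⊛ g 𝕊.≋ f 𝕊.· g
  ⊛≋· f g zero = ℤₚ.+-identityˡ _
  ⊛≋· f g (suc n) = trans (sumBelow-shift (suc n) (λ i → f i * g (suc n ℕ.∸ i))) (cong (f 0 * g (suc n) +_) (⊛≋· (𝕊.tail f) g n))
    where
    sumBelow-shift : ∀ n h → sumBelow (suc n) h ≡ h 0 + sumBelow n (h ∘ suc)
    sumBelow-shift zero h = ℤₚ.+-comm 0ℤ (h 0)
    sumBelow-shift (suc n) h = trans (cong (_+ h (suc n)) (sumBelow-shift n h)) (ℤₚ.+-assoc (h 0) _ _)

  polyX-cons : ∀ p ps → polyX (p ∷ ps) 𝕊.≋ 𝕊.const p 𝕊R.+ 𝕊.X 𝕊.· polyX ps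
  polyX-cons p ps zero = sym (trans (cong (p +_) (𝕊.X-·-zero (polyX ps))) (ℤₚ.+-identityʳ p))
  polyX-cons p ps (suc n) = sym (trans (ℤₚ.+-identityˡ _) (𝕊.X-·-suc (polyX ps) n))

  polyX-tabulate : ∀ {A} (z : Fin A → ℤ) →
    polyX (List.tabulate z) 𝕊.≋ 𝕊Σ.sum (λ a → 𝕊.const (z a) 𝕊.· 𝕊.X 𝕊^.^ toℕ a)
  polyX-tabulate {zero} z n = refl
  polyX-tabulate {suc A} z = begin
    polyX (List.tabulate z)
      ≈⟨ polyX-cons (z zero) (List.tabulate (z ∘ suc)) ⟩
    𝕊.const (z zero) 𝕊R.+ 𝕊.X 𝕊.· polyX (List.tabulate (z ∘ suc))
      ≈⟨ 𝕊R.+-cong (𝕊R.sym (𝕊R.*-identityʳ (𝕊.const (z zero)))) (𝕊R.trans (𝕊R.*-congˡ (polyX-tabulate (z ∘ suc)))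
           (𝕊R.trans (𝕊Σ.*-distribˡ-sum 𝕊.X (λ a → 𝕊.const (z (suc a)) 𝕊.· 𝕊.X 𝕊^.^ toℕ a))
             (𝕊Σ.sum-cong-≋ (λ a → x∙yz≈y∙xz 𝕊.X (𝕊.const (z (suc a))) (𝕊.X 𝕊^.^ toℕ a))))) ⟩
    𝕊Σ.sum (λ a → 𝕊.const (z a) 𝕊.· 𝕊.X 𝕊^.^ toℕ a) ∎
    where
    open import Relation.Binary.Reasoning.Setoid 𝕊R.setoid
    open import Algebra.Properties.CommutativeSemigroup 𝕊R.*-commutativeSemigroup using (x∙yz≈y∙xz)

  evalP-tabulate : ∀ {K} (p : Fin K → List ℤ) Y →
    evalP (List.tabulate p) Y 𝕊.≋ 𝕊Σ.sum (λ k → polyX (p k) 𝕊.· Y 𝕊^.^ toℕ k)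
  evalP-tabulate {zero} p Y n = refl
  evalP-tabulate {suc K} p Y = begin
    polyX (p zero) 𝕊R.+ Y ⊛ evalP (List.tabulate (p ∘ suc)) Y
      ≈⟨ 𝕊R.+-cong (𝕊R.sym (𝕊R.*-identityʳ (polyX (p zero)))) (𝕊R.trans (⊛≋· Y (evalP (List.tabulate (p ∘ suc)) Y))
           (𝕊R.trans (𝕊R.*-congˡ {Y} (evalP-tabulate (p ∘ suc) Y))
             (𝕊R.trans (𝕊Σ.*-distribˡ-sum Y (λ k → polyX (p (suc k)) 𝕊.· Y 𝕊^.^ toℕ k))
               (𝕊Σ.sum-cong-≋ (λ k → x∙yz≈y∙xz Y (polyX (p (suc k))) (Y 𝕊^.^ toℕ k)))))) ⟩
    𝕊Σ.sum (λ k → polyX (p k) 𝕊.· Y 𝕊^.^ toℕ k) ∎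
    where
    open import Relation.Binary.Reasoning.Setoid 𝕊R.setoid
    open import Algebra.Properties.CommutativeSemigroup 𝕊R.*-commutativeSemigroup using (x∙yz≈y∙xz)

  x t : 𝔹.Series
  x = 𝔹.X
  t = 𝔹.const 𝕊.X

  ι : ℤ → 𝔹.Series
  ι = 𝔹.const ∘ 𝕊.const

  ι-hom : RingMorphisms.IsRingHomomorphism (CommutativeRing.rawRing ℤₚ.+-*-commutativeRing) 𝔹R.rawRing ι
  ι-hom = isRingHomomorphism 𝔹R.trans 𝕊.const-isRingHomomorphism 𝔹.const-isRingHomomorphism

  x-regular : ∀ u → x 𝔹.· u 𝔹.≋ 𝔹R.0# → u 𝔹.≋ 𝔹R.0#
  x-regular u p n = 𝕊R.trans (𝕊R.sym (𝔹.X-·-suc u n)) (p (suc n))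

  t-regular : ∀ u → t 𝔹.· u 𝔹.≋ 𝔹R.0# → u 𝔹.≋ 𝔹R.0#
  t-regular u p n k = trans (sym (trans (𝔹.const-· 𝕊.X u n (suc k)) (𝕊.X-·-suc (u n) k))) (p n (suc k))

  -- The value at t = 0: the inner variable of 𝔹 is t and the outer one x.
  at0 : 𝔹.Series → FPS
  at0 f n = f n 0

  at0-· : ∀ f g → at0 (f 𝔹.· g) 𝕊.≋ at0 f 𝕊.· at0 g
  at0-· f g zero = refl
  at0-· f g (suc n) = cong (f 0 0 * g (suc n) 0 +_) (at0-· (𝔹.tail f) g n)

  at0-const : ∀ a → at0 (𝔹.const a) 𝕊.≋ 𝕊.const (a 0)
  at0-const a zero = refl
  at0-const a (suc n) = refl

  at0-x : at0 x 𝕊.≋ 𝕊.X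
  at0-x zero = refl
  at0-x (suc n) = at0-const 𝕊R.1# n

  at0-t· : ∀ u → at0 (t 𝔹.· u) 𝕊.≋ 𝕊R.0#
  at0-t· u n = trans (𝔹.const-· 𝕊.X u n 0) (𝕊.X-·-zero (u n))

  at0-^ : ∀ f k → at0 (f 𝔹^.^ k) 𝕊.≋ at0 f 𝕊^.^ k
  at0-^ f zero = at0-const 𝕊R.1#
  at0-^ f (suc k) = 𝕊R.trans (at0-· f (f 𝔹^.^ k)) (𝕊R.*-congˡ {at0 f} (at0-^ f k))

  at0-sum : ∀ {n} (f : Fin n → 𝔹.Series) → at0 (𝔹Σ.sum f) 𝕊.≋ 𝕊Σ.sum (at0 ∘ f)
  at0-sum {zero} f n = refl
  at0-sum {suc m} f n = cong (at0 (f zero) n +_) (at0-sum (f ∘ suc) n)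

  at0-quadratic : ∀ {d} (y : Fin d → 𝔹.Series) P → at0 (𝔹L.quadratic y P) 𝕊.≋ 𝕊L.quadratic (at0 ∘ y) P
  at0-quadratic y [] n = refl
  at0-quadratic y ((j , k) ∷ P) n = cong₂ _+_ (at0-· (y j) (y k) n) (at0-quadratic y P n)

  module Solution {d : ℕ} (γ : Fin d → ℤ) (P : Fin d → List (Fin d × Fin d)) where

    Ψ : (Fin d → 𝔹.Series) → Fin d → 𝔹.Series
    Ψ y i = 𝔹L.quadratic y (P i) 𝔹R.+ t 𝔹.· (y i 𝔹.· (y i 𝔹.· y i))

    Ψ-local : ∀ n {y y′} → (∀ i → 𝔹.EqualUpTo n (y i) (y′ i)) → ∀ i → Ψ y i n 𝕊.≋ Ψ y′ i n
    Ψ-local n {y} {y′} h i = 𝕊R.+-cong (products (P i))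
      (𝔹.·-cong-upTo n (λ k k≤n → 𝕊R.refl) (𝔹.·-EqualUpTo (h i) (𝔹.·-EqualUpTo (h i) (h i))))
      where
      products : ∀ Q → 𝔹L.quadratic y Q n 𝕊.≋ 𝔹L.quadratic y′ Q n
      products [] m = refl
      products ((j , k) ∷ Q) = 𝕊R.+-cong (𝔹.·-cong-upTo n (h j) (h k)) (products Q)

    approximant : ℕ → Fin d → 𝔹.Series
    approximant zero i = 𝔹R.0#
    approximant (suc m) i zero = 𝕊.const (γ i)
    approximant (suc m) i (suc n) = Ψ (approximant m) i n

    -- Coefficient n + 1 of an iterate is computed from the coefficients up to n of the previous
    -- iterate, so iterate m is final below index m.
    stable : ∀ m m′ n → n ℕ.< m → n ℕ.< m′ → ∀ i → approximant m i n 𝕊.≋ approximant m′ i n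
    stable (suc m) (suc m′) zero _ _ i k = refl
    stable (suc m) (suc m′) (suc n) (s≤s n<m) (s≤s n<m′) =
      Ψ-local n (λ i k k≤n → stable m m′ k (ℕₚ.≤-<-trans k≤n n<m) (ℕₚ.≤-<-trans k≤n n<m′) i)

    y : Fin d → 𝔹.Series
    y i n = approximant (suc n) i n

    y-suc : ∀ i n → y i (suc n) 𝕊.≋ Ψ y i n
    y-suc i n = Ψ-local n (λ j k k≤n → stable (suc n) (suc k) k (s≤s k≤n) ℕₚ.≤-refl j) i

    y-system : ∀ i → y i 𝔹.≋ ι (γ i) 𝔹R.+ x 𝔹.· Ψ y i
    y-system i zero = 𝕊R.sym (𝕊R.trans (𝕊R.+-congˡ {𝕊.const (γ i)} (𝔹.X-·-zero (Ψ y i))) (𝕊R.+-identityʳ _))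
    y-system i (suc n) = 𝕊R.trans (y-suc i n)
      (𝕊R.sym (𝕊R.trans (𝕊R.+-identityˡ ((x 𝔹.· Ψ y i) (suc n))) (𝔹.X-·-suc (Ψ y i) n)))

    Y : Fin d → FPS
    Y i = at0 (y i)

    -- The cubic term carries the factor t, so at t = 0 the unperturbed system is left.
    Y-suc : ∀ i → 𝕊.tail (Y i) 𝕊.≋ 𝕊L.quadratic Y (P i)
    Y-suc i n = begin
      y i (suc n) 0                               ≡⟨ y-suc i n 0 ⟩
      at0 (𝔹L.quadratic y (P i)) n + at0 (t 𝔹.· cube) n ≡⟨ cong₂ _+_ (at0-quadratic y (P i) n) (at0-t· cube n) ⟩
      𝕊L.quadratic Y (P i) n + 0ℤ                 ≡⟨ ℤₚ.+-identityʳ _ ⟩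
      𝕊L.quadratic Y (P i) n                      ∎
      where
      open ≡-Reasoning
      cube = y i 𝔹.· (y i 𝔹.· y i)

    module E = Elimination 𝔹.seriesRing ι ι-hom x t

    module _ (i : Fin d) where

      polynomial : ∀ {K A} → (Fin K → Fin A → ℤ) → 𝔹.Series
      polynomial = E.polynomial y γ P y-system x-regular t-regular i

      polynomial-0 : ∀ {K A} (z : Fin K → Fin A → ℤ) → (∀ k a → z k a ≡ 0ℤ) → polynomial z 𝔹.≋ 𝔹R.0#
      polynomial-0 z z≡0 = 𝔹Σ.sum-zero (λ k → 𝔹Σ.sum-zero (λ a →
        𝔹R.trans (𝔹R.*-congʳ {m k a} (𝔹R.trans (𝔹R.reflexive (cong ι (z≡0 k a)))
          (RingMorphisms.IsRingHomomorphism.0#-homo ι-hom))) (𝔹R.zeroˡ (m k a))))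
        where
        m = λ k a → x 𝔹^.^ toℕ a 𝔹.· y i 𝔹^.^ toℕ k

      -- Divide by the largest power of t and set t = 0.
      specialise : ∀ {B K A} (z : Fin B → Fin K → Fin A → ℤ) → (∃ λ b → ∃ λ k → ∃ λ a → z b k a ≢ 0ℤ) →
        𝔹Σ.sum (λ b → t 𝔹^.^ toℕ b 𝔹.· polynomial (z b)) 𝔹.≋ 𝔹R.0# →
        ∃ λ (z₀ : Fin K → Fin A → ℤ) → (∃ λ k → ∃ λ a → z₀ k a ≢ 0ℤ) × at0 (polynomial z₀) 𝕊.≋ 𝕊R.0#
      specialise {suc B} z (b₀ , k₀ , a₀ , z≢0) rel with any? (λ k → any? (λ a → ¬? (z zero k a ℤ.≟ 0ℤ)))
      -- At t = 0 only the summand b = 0 survives, and it has a non-zero coefficient.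
      ... | yes nonzero = z zero , nonzero , at0-head
        where
        at0-head : at0 (polynomial (z zero)) 𝕊.≋ 𝕊R.0#
        at0-head n = begin
          at0 (polynomial (z zero)) n
            ≡⟨ ℤₚ.+-identityʳ _ ⟨
          at0 (polynomial (z zero)) n + 0ℤ
            ≡⟨ cong₂ _+_ (𝔹R.*-identityˡ (polynomial (z zero)) n 0)
                 (trans (at0-sum {B} (λ b → t 𝔹^.^ suc (toℕ b) 𝔹.· polynomial (z (suc b))) n)
                   (𝕊Σ.sum-zero {B} (λ b m → trans (𝔹R.*-assoc t (t 𝔹^.^ toℕ b) (polynomial (z (suc b))) m 0)
                     (at0-t· (t 𝔹^.^ toℕ b 𝔹.· polynomial (z (suc b))) m)) n)) ⟨
          at0 (𝔹Σ.sum (λ b → t 𝔹^.^ toℕ b 𝔹.· polynomial (z b))) n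
            ≡⟨ rel n 0 ⟩
          0ℤ ∎
          where open ≡-Reasoning
      -- The whole relation is divisible by t; one factor is cancelled and the number of summands
      -- decreases.
      ... | no all-zero = specialise (z ∘ suc) (tail-nonzero b₀ z≢0) (t-regular _ (begin
          t 𝔹.· 𝔹Σ.sum (λ b → t 𝔹^.^ toℕ b 𝔹.· polynomial (z (suc b)))
            ≈⟨ 𝔹Σ.*-distribˡ-sum t (λ b → t 𝔹^.^ toℕ b 𝔹.· polynomial (z (suc b))) ⟩
          𝔹Σ.sum (λ b → t 𝔹.· (t 𝔹^.^ toℕ b 𝔹.· polynomial (z (suc b))))
            ≈⟨ 𝔹Σ.sum-cong-≋ {B} (λ b → 𝔹R.*-assoc t (t 𝔹^.^ toℕ b) (polynomial (z (suc b)))) ⟨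
          rest
            ≈⟨ 𝔹R.+-identityˡ rest ⟨
          𝔹R.0# 𝔹R.+ rest
            ≈⟨ 𝔹R.+-congʳ {rest} (𝔹R.trans (𝔹R.*-congˡ {𝔹R.1#} (polynomial-0 (z zero) z≡0)) (𝔹R.zeroʳ 𝔹R.1#)) ⟨
          𝔹Σ.sum (λ b → t 𝔹^.^ toℕ b 𝔹.· polynomial (z b))
            ≈⟨ rel ⟩
          𝔹R.0# ∎))
        where
        open import Relation.Binary.Reasoning.Setoid 𝔹R.setoid
        rest = 𝔹Σ.sum (λ b → t 𝔹^.^ suc (toℕ b) 𝔹.· polynomial (z (suc b)))
        z≡0 : ∀ k a → z zero k a ≡ 0ℤ
        z≡0 k a = decidable-stable (_ ℤ.≟ _) (λ ≢0 → all-zero (k , a , ≢0))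
        tail-nonzero : ∀ b → z b k₀ a₀ ≢ 0ℤ → ∃ λ b → ∃ λ k → ∃ λ a → z (suc b) k a ≢ 0ℤ
        tail-nonzero zero ≢0 = contradiction (z≡0 k₀ a₀) ≢0
        tail-nonzero (suc b) ≢0 = b , k₀ , a₀ , ≢0

      at0-polynomial : ∀ {K A} (z : Fin K → Fin A → ℤ) →
        at0 (polynomial z) 𝕊.≋ evalP (List.tabulate (λ k → List.tabulate (z k))) (Y i)
      at0-polynomial {K} {A} z = begin
        at0 (polynomial z)
          ≈⟨ at0-sum (λ k → 𝔹Σ.sum (λ a → term k a)) ⟩
        𝕊Σ.sum (λ k → at0 (𝔹Σ.sum (λ a → term k a)))
          ≈⟨ 𝕊Σ.sum-cong-≋ {K} (λ k → 𝕊R.trans (at0-sum (λ a → term k a)) (𝕊R.trans (𝕊Σ.sum-cong-≋ {A} (at0-term k))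
               (𝕊R.trans (𝕊R.sym (𝕊Σ.*-distribʳ-sum (Y i 𝕊^.^ toℕ k) (λ a → 𝕊.const (z k a) 𝕊.· 𝕊.X 𝕊^.^ toℕ a)))
                 (𝕊R.*-congʳ {Y i 𝕊^.^ toℕ k} (𝕊R.sym (polyX-tabulate (z k))))))) ⟩
        𝕊Σ.sum (λ k → polyX (List.tabulate (z k)) 𝕊.· Y i 𝕊^.^ toℕ k)
          ≈⟨ evalP-tabulate (λ k → List.tabulate (z k)) (Y i) ⟨
        evalP (List.tabulate (λ k → List.tabulate (z k))) (Y i) ∎
        where
        open import Relation.Binary.Reasoning.Setoid 𝕊R.setoid
        term : Fin K → Fin A → 𝔹.Series
        term k a = ι (z k a) 𝔹.· (x 𝔹^.^ toℕ a 𝔹.· y i 𝔹^.^ toℕ k)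
        at0-term : ∀ k a → at0 (term k a) 𝕊.≋ (𝕊.const (z k a) 𝕊.· 𝕊.X 𝕊^.^ toℕ a) 𝕊.· Y i 𝕊^.^ toℕ k
        at0-term k a = begin
          at0 (term k a)
            ≈⟨ at0-· (ι (z k a)) (x 𝔹^.^ toℕ a 𝔹.· y i 𝔹^.^ toℕ k) ⟩
          at0 (ι (z k a)) 𝕊.· at0 (x 𝔹^.^ toℕ a 𝔹.· y i 𝔹^.^ toℕ k)
            ≈⟨ 𝕊R.*-cong (at0-const (𝕊.const (z k a))) (𝕊R.trans (at0-· (x 𝔹^.^ toℕ a) (y i 𝔹^.^ toℕ k))
                 (𝕊R.*-cong (𝕊R.trans (at0-^ x (toℕ a)) (𝕊^.^-congˡ (toℕ a) at0-x)) (at0-^ (y i) (toℕ k)))) ⟩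
          𝕊.const (z k a) 𝕊.· (𝕊.X 𝕊^.^ toℕ a 𝕊.· Y i 𝕊^.^ toℕ k)
            ≈⟨ 𝕊R.*-assoc (𝕊.const (z k a)) (𝕊.X 𝕊^.^ toℕ a) (Y i 𝕊^.^ toℕ k) ⟨
          (𝕊.const (z k a) 𝕊.· 𝕊.X 𝕊^.^ toℕ a) 𝕊.· Y i 𝕊^.^ toℕ k ∎

      annihilator⇒algebraic : (∃ λ A → ∃ λ K → ∃ λ (z : Fin A → Fin K → Fin A → ℤ) →
        (∃ λ b → ∃ λ k → ∃ λ a → z b k a ≢ 0ℤ) × 𝔹Σ.sum (λ b → t 𝔹^.^ toℕ b 𝔹.· polynomial (z b)) 𝔹.≋ 𝔹R.0#) →
        IsAlgebraic (Y i)
      annihilator⇒algebraic (A , K , z , nonzero , rel) =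
        let z₀ , (k , a , z₀≢0) , rel₀ = specialise z nonzero rel
        in List.tabulate (λ k → List.tabulate (z₀ k)) , tabulate⁺ k (tabulate⁺ a z₀≢0) ,
           λ n → trans (sym (at0-polynomial z₀ n)) (rel₀ n)

      Y-algebraic : IsAlgebraic (Y i)
      Y-algebraic = annihilator⇒algebraic (E.annihilator y γ P y-system x-regular t-regular i)

  -- Initial values and tails determine every coefficient; this is how counting sequences are
  -- recognised in the solution later.
  quadratic-system : ∀ {d} (γ : Fin d → ℤ) (P : Fin d → List (Fin d × Fin d)) → ∃ λ (Y : Fin d → FPS) →
    (∀ i → Y i 0 ≡ γ i) × (∀ i → 𝕊.tail (Y i) 𝕊.≋ 𝕊L.quadratic Y (P i)) × (∀ i → IsAlgebraic (Y i))
  quadratic-system γ P = Y , (λ i → refl) , Y-suc , Y-algebraic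
    where open Solution γ P

-- Generating functions of automata with one counter.

module CounterAutomata where
  open import Defs using (FPS; polyX; evalP; IsAlgebraic)
  open SeriesRing
  open LinearDependence
  open CubicElimination
  open QuadraticSystems
  open import Algebra.Bundles using (CommutativeRing)
  open import Data.Bool using (Bool; true; false; if_then_else_)
  open import Data.Nat as ℕ using (ℕ; zero; suc)
  open import Data.Integer using (ℤ; 0ℤ; 1ℤ; _+_; _*_)
  import Data.Integer.Properties as ℤₚ
  open import Data.Fin using (Fin; zero; suc; combine; remQuot; splitAt; _↑ˡ_; _↑ʳ_; _≟_)
  open import Data.Fin.Properties using (remQuot-combine; splitAt-↑ˡ; splitAt-↑ʳ)
  open import Data.List as List using (List; []; _∷_; concatMap)
  open import Data.Maybe as Maybe using (Maybe; just; nothing)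
  open import Data.Product as Product using (∃; _×_; _,_; proj₁; proj₂; uncurry)
  open import Data.Sum using ([_,_]′)
  open import Function using (_∘_)
  open import Relation.Nullary using (yes; no; contradiction; does)
  open import Relation.Binary.PropositionalEquality using (_≡_; _≢_; _≗_; refl; sym; trans; cong; cong₂)

  module ListSumProperties {c ℓ} (Ω : CommutativeRing c ℓ) where
    private module R = CommutativeRing Ω
    open R using (_≈_; Carrier; 0#)
    open ListSum Ω
    open FinSum Ω
    open import Algebra.Properties.CommutativeSemigroup R.+-commutativeSemigroup using (interchange)

    lsum-cong : ∀ {a} {A : Set a} {f g : A → Carrier} → (∀ x → f x ≈ g x) → ∀ xs → lsum f xs ≈ lsum g xs
    lsum-cong p [] = R.refl
    lsum-cong p (x ∷ xs) = R.+-cong (p x) (lsum-cong p xs)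

    lsum-++ : ∀ {a} {A : Set a} (f : A → Carrier) xs ys → lsum f (xs List.++ ys) ≈ lsum f xs R.+ lsum f ys
    lsum-++ f [] ys = R.sym (R.+-identityˡ _)
    lsum-++ f (x ∷ xs) ys = R.trans (R.+-congˡ (lsum-++ f xs ys)) (R.sym (R.+-assoc _ _ _))

    lsum-concatMap : ∀ {a b} {A : Set a} {B : Set b} (f : B → Carrier) (g : A → List B) xs →
      lsum f (concatMap g xs) ≈ lsum (lsum f ∘ g) xs
    lsum-concatMap f g [] = R.refl
    lsum-concatMap f g (x ∷ xs) = R.trans (lsum-++ f (g x) (concatMap g xs)) (R.+-congˡ (lsum-concatMap f g xs))

    lsum-map : ∀ {a b} {A : Set a} {B : Set b} (f : B → Carrier) (g : A → B) xs → lsum f (List.map g xs) ≈ lsum (f ∘ g) xs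
    lsum-map f g [] = R.refl
    lsum-map f g (x ∷ xs) = R.+-congˡ (lsum-map f g xs)

    lsum-tabulate : ∀ {a} {A : Set a} {n} (f : A → Carrier) (g : Fin n → A) → lsum f (List.tabulate g) ≈ sum (f ∘ g)
    lsum-tabulate {n = zero} f g = R.refl
    lsum-tabulate {n = suc n} f g = R.+-congˡ (lsum-tabulate f (g ∘ suc))

    lsum-+ : ∀ {a} {A : Set a} (f g : A → Carrier) xs → lsum (λ x → f x R.+ g x) xs ≈ lsum f xs R.+ lsum g xs
    lsum-+ f g [] = R.sym (R.+-identityˡ _)
    lsum-+ f g (x ∷ xs) = R.trans (R.+-congˡ (lsum-+ f g xs)) (interchange _ _ _ _)

    lsum-*ʳ : ∀ {a} {A : Set a} (f : A → Carrier) u xs → lsum f xs R.* u ≈ lsum (λ x → f x R.* u) xs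
    lsum-*ʳ f u [] = R.zeroˡ u
    lsum-*ʳ f u (x ∷ xs) = R.trans (R.distribʳ u _ _) (R.+-congˡ (lsum-*ʳ f u xs))

    sum-lsum : ∀ {a} {A : Set a} {n} (f : Fin n → A → Carrier) xs →
      sum (λ i → lsum (f i) xs) ≈ lsum (λ x → sum (λ i → f i x)) xs
    sum-lsum {n = n} f [] = sum-replicate-zero n
    sum-lsum f (x ∷ xs) = R.trans (∑-distrib-+ (λ i → f i x) (λ i → lsum (f i) xs)) (R.+-congˡ (sum-lsum f xs))

  module 𝕊LP = ListSumProperties 𝕊.seriesRing
  module ℤL = ListSum ℤₚ.+-*-commutativeRing

  evalP-cong : ∀ P {F G} → F ≗ G → evalP P F ≗ evalP P G
  evalP-cong [] p n = refl
  evalP-cong (q ∷ P) {F} {G} p n = cong (polyX q n +_) (trans (⊛≋· F (evalP P F) n)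
    (trans (𝕊.·-cong p (evalP-cong P p) n) (sym (⊛≋· G (evalP P G) n))))

  IsAlgebraic-resp : ∀ {F G} → F ≗ G → IsAlgebraic F → IsAlgebraic G
  IsAlgebraic-resp p (P , nonzero , zeroP) = P , nonzero , λ n → trans (sym (evalP-cong P p n)) (zeroP n)

  data Move : Set where
    down stay up : Move

  -- The argument is one less than the current level: from the positive level `suc l` the run passes
  -- to `move v l`, so that no move leads below 0.
  move : Move → ℕ → ℕ
  move down l = l
  move stay l = suc l
  move up l = suc (suc l)

  -- A deterministic automaton with one counter, whose transitions do not depend on the counter as long as it is positive.
  module CounterAutomaton {Label : Set} (S : List Label) {m : ℕ}
    (δ : Fin m → Label → Fin m × Move) (δ₀ : Fin m → Label → Maybe (Fin m × Bool)) (accept : Fin m → ℤ) where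

    Configuration : Set
    Configuration = Maybe (Fin m × ℕ)

    step : Fin m × ℕ → Label → Configuration
    step (q , zero) s = Maybe.map (Product.map₂ (λ b → if b then 1 else 0)) (δ₀ q s)
    step (q , suc l) s = just (proj₁ (δ q s) , move (proj₂ (δ q s)) l)

    run : ℕ → Configuration → ℤ
    run n nothing = 0ℤ
    run zero (just (q , l)) = accept q
    run (suc n) (just c) = ℤL.lsum (λ s → run n (step c s)) S

    -- G q p counts the walks from q at level l+1 that first reach level l in state p,
    -- E q the accepted walks from level l+1 staying above level l, and F q all accepted walks from level 0.
    data Unknown : Set where
      one : Unknown
      G : Fin m → Fin m → Unknown
      E F : Fin m → Unknown

    d : ℕ
    d = suc (m ℕ.* m ℕ.+ (m ℕ.+ m))

    encode : Unknown → Fin d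
    encode one = zero
    encode (G q p) = suc (combine q p ↑ˡ (m ℕ.+ m))
    encode (E q) = suc ((m ℕ.* m) ↑ʳ (q ↑ˡ m))
    encode (F q) = suc ((m ℕ.* m) ↑ʳ (m ↑ʳ q))

    decode : Fin d → Unknown
    decode zero = one
    decode (suc i) = [ uncurry G ∘ remQuot m , [ E , F ]′ ∘ splitAt m ]′ (splitAt (m ℕ.* m) i)

    decode-encode : ∀ u → decode (encode u) ≡ u
    decode-encode one = refl
    decode-encode (G q p) rewrite splitAt-↑ˡ (m ℕ.* m) (combine q p) (m ℕ.+ m) = cong (uncurry G) (remQuot-combine q p)
    decode-encode (E q) rewrite splitAt-↑ʳ (m ℕ.* m) (m ℕ.+ m) (q ↑ˡ m) | splitAt-↑ˡ m q m = refl
    decode-encode (F q) rewrite splitAt-↑ʳ (m ℕ.* m) (m ℕ.+ m) (m ↑ʳ q) | splitAt-↑ʳ m m q = refl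

    Products : Set
    Products = List (Unknown × Unknown)

    -- First-step analysis of a descent by one level: after `up` the run has to return to its
    -- starting level in some state r and then descend once more. The unknown `one` pads linear and
    -- constant terms to quadratic ones.
    contribution-G : Fin m → Fin m × Move → Products
    contribution-G p (q , down) = if does (p ≟ q) then (one , one) ∷ [] else []
    contribution-G p (q , stay) = (one , G q p) ∷ []
    contribution-G p (q , up) = List.tabulate (λ r → G q r , G r p)

    -- After `up` the run either remains above its starting level or comes back to it in some state
    -- r. The same alternative occurs in `contribution-F`.
    contribution-E : Fin m × Move → Products
    contribution-E (q , down) = []
    contribution-E (q , stay) = (one , E q) ∷ []
    contribution-E (q , up) = (one , E q) ∷ List.tabulate (λ r → G q r , E r)

    contribution-F : Maybe (Fin m × Bool) → Products
    contribution-F nothing = []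
    contribution-F (just (q , false)) = (one , F q) ∷ []
    contribution-F (just (q , true)) = (one , E q) ∷ List.tabulate (λ r → G q r , F r)

    initial : Unknown → ℤ
    initial one = 1ℤ
    initial (G q p) = 0ℤ
    initial (E q) = accept q
    initial (F q) = accept q

    products : Unknown → Products
    products one = []
    products (G q p) = concatMap (λ s → contribution-G p (δ q s)) S
    products (E q) = concatMap (λ s → contribution-E (δ q s)) S
    products (F q) = concatMap (λ s → contribution-F (δ₀ q s)) S

    solution : ∃ λ (Y : Fin d → FPS) → (∀ i → Y i 0 ≡ initial (decode i)) ×
      (∀ i → 𝕊.tail (Y i) 𝕊.≋ 𝕊L.quadratic Y (List.map (Product.map encode encode) (products (decode i)))) ×
      (∀ i → IsAlgebraic (Y i))
    solution = quadratic-system (initial ∘ decode) (List.map (Product.map encode encode) ∘ products ∘ decode)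

    module Decomposition (Y : Fin d → FPS) (Y-initial : ∀ i → Y i 0 ≡ initial (decode i))
      (Y-tail : ∀ i → 𝕊.tail (Y i) 𝕊.≋ 𝕊L.quadratic Y (List.map (Product.map encode encode) (products (decode i)))) where

      open 𝕊Σ using (sum)
      open 𝕊L using (lsum)
      open 𝕊 using (_·_; _≋_; tail)
      open import Relation.Binary.Reasoning.Setoid 𝕊R.setoid

      y : Unknown → FPS
      y = Y ∘ encode

      value : Products → FPS
      value = lsum (λ p → y (proj₁ p) · y (proj₂ p))

      y-initial : ∀ u → y u 0 ≡ initial u
      y-initial u = trans (Y-initial (encode u)) (cong initial (decode-encode u))

      y-tail : ∀ u → tail (y u) ≋ value (products u)
      y-tail u n = trans (Y-tail (encode u) n) (trans (cong (λ v → 𝕊L.quadratic Y (List.map _ (products v)) n) (decode-encode u))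
        (𝕊LP.lsum-map (λ p → Y (proj₁ p) · Y (proj₂ p)) (Product.map encode encode) (products u) n))

      y-one : y one ≋ 𝕊R.1#
      y-one zero = y-initial one
      y-one (suc n) = y-tail one n

      one· : ∀ u → y one · u ≋ u
      one· u = 𝕊R.trans (𝕊R.*-congʳ {u} y-one) (𝕊R.*-identityˡ u)

      value-single : ∀ u → value ((one , u) ∷ []) ≋ y u
      value-single u = 𝕊R.trans (𝕊R.+-identityʳ (y one · y u)) (one· (y u))

      -- All accepted runs from state q and level l. A run from a positive level either never
      -- reaches the next lower level or is cut at its first arrival there.
      Φ : Fin m → ℕ → FPS
      Φ q zero = y (F q)
      Φ q (suc l) = y (E q) 𝕊R.+ sum (λ p → y (G q p) · Φ p l)

      Φ′ : Configuration → FPS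
      Φ′ nothing = 𝕊R.0#
      Φ′ (just (q , l)) = Φ q l

      tail-F : ∀ c → value (contribution-F c) ≋ Φ′ (Maybe.map (Product.map₂ (λ b → if b then 1 else 0)) c)
      tail-F nothing = 𝕊R.refl
      tail-F (just (q , false)) = value-single (F q)
      tail-F (just (q , true)) = 𝕊R.+-cong (one· (y (E q)))
        (𝕊LP.lsum-tabulate (λ p → y (proj₁ p) · y (proj₂ p)) (λ r → G q r , F r))

      -- The effect of one transition at level `suc l`. After `up` the first-passage decomposition
      -- is applied twice, from `suc (suc l)` down to `l`, which produces the products in the
      -- contributions.
      tail-EG : ∀ c l → value (contribution-E c) 𝕊R.+ sum (λ p → value (contribution-G p c) · Φ p l)
        ≋ Φ (proj₁ c) (move (proj₂ c) l)
      tail-EG (q , down) l = 𝕊R.trans (𝕊R.+-identityˡ _)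
        (𝕊R.trans (𝕊Σ.sum-single q {λ p → value (contribution-G p (q , down)) · Φ p l} off) on)
        where
        off : ∀ p → p ≢ q → value (contribution-G p (q , down)) · Φ p l ≋ 𝕊R.0#
        off p p≢q with p ≟ q
        ... | yes p≡q = contradiction p≡q p≢q
        ... | no _ = 𝕊R.zeroˡ (Φ p l)
        on : value (contribution-G q (q , down)) · Φ q l ≋ Φ q l
        on with q ≟ q
        ... | no q≢q = contradiction refl q≢q
        ... | yes _ = 𝕊R.trans (𝕊R.*-congʳ {Φ q l} (𝕊R.trans (value-single one) y-one)) (𝕊R.*-identityˡ (Φ q l))
      tail-EG (q , stay) l = 𝕊R.+-cong (value-single (E q))
        (𝕊Σ.sum-cong-≋ (λ p → 𝕊R.*-congʳ {Φ p l} (value-single (G q p))))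
      tail-EG (q , up) l = begin
        (y one · y (E q) 𝕊R.+ value (List.tabulate (λ r → G q r , E r)))
          𝕊R.+ sum (λ p → value (List.tabulate (λ r → G q r , G r p)) · Φ p l)
          ≈⟨ 𝕊R.+-cong
               (𝕊R.+-cong (one· (y (E q))) (𝕊LP.lsum-tabulate (λ p → y (proj₁ p) · y (proj₂ p)) (λ r → G q r , E r)))
               (𝕊R.trans (𝕊Σ.sum-cong-≋ expand)
                 (𝕊R.trans (𝕊Σ.∑-comm (λ p r → y (G q r) · (y (G r p) · Φ p l)))
                   (𝕊Σ.sum-cong-≋ (λ r → 𝕊R.sym (𝕊Σ.*-distribˡ-sum (y (G q r)) (λ p → y (G r p) · Φ p l)))))) ⟩
        (y (E q) 𝕊R.+ sum (λ r → y (G q r) · y (E r))) 𝕊R.+ sum (λ r → y (G q r) · sum (λ p → y (G r p) · Φ p l))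
          ≈⟨ 𝕊R.+-assoc (y (E q)) (sum (λ r → y (G q r) · y (E r))) (sum (λ r → y (G q r) · sum (λ p → y (G r p) · Φ p l))) ⟩
        y (E q) 𝕊R.+ (sum (λ r → y (G q r) · y (E r)) 𝕊R.+ sum (λ r → y (G q r) · sum (λ p → y (G r p) · Φ p l)))
          ≈⟨ 𝕊R.+-congˡ {y (E q)} (𝕊R.trans
               (𝕊R.sym (𝕊Σ.∑-distrib-+ (λ r → y (G q r) · y (E r)) (λ r → y (G q r) · sum (λ p → y (G r p) · Φ p l))))
               (𝕊Σ.sum-cong-≋ (λ r → 𝕊R.sym (𝕊R.distribˡ (y (G q r)) (y (E r)) (sum (λ p → y (G r p) · Φ p l)))))) ⟩
        y (E q) 𝕊R.+ sum (λ r → y (G q r) · Φ r (suc l)) ∎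
        where
        expand : ∀ p → value (List.tabulate (λ r → G q r , G r p)) · Φ p l ≋ sum (λ r → y (G q r) · (y (G r p) · Φ p l))
        expand p = 𝕊R.trans
          (𝕊R.*-congʳ {Φ p l} (𝕊LP.lsum-tabulate (λ p → y (proj₁ p) · y (proj₂ p)) (λ r → G q r , G r p)))
          (𝕊R.trans (𝕊Σ.*-distribʳ-sum (Φ p l) (λ r → y (G q r) · y (G r p)))
            (𝕊Σ.sum-cong-≋ (λ r → 𝕊R.*-assoc (y (G q r)) (y (G r p)) (Φ p l))))

      tail-sum : ∀ {n} (f : Fin n → FPS) → tail (sum f) ≋ sum (tail ∘ f)
      tail-sum {zero} f k = refl
      tail-sum {suc n} f k = cong (f zero (suc k) +_) (tail-sum (f ∘ suc) k)

      tail-Φ : ∀ c → tail (Φ′ (just c)) ≋ lsum (λ s → Φ′ (step c s)) S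
      tail-Φ (q , zero) = 𝕊R.trans (y-tail (F q)) (𝕊R.trans
        (𝕊LP.lsum-concatMap (λ p → y (proj₁ p) · y (proj₂ p)) (λ s → contribution-F (δ₀ q s)) S)
        (𝕊LP.lsum-cong (λ s → tail-F (δ₀ q s)) S))
      tail-Φ (q , suc l) = begin
        tail (y (E q)) 𝕊R.+ tail (sum (λ p → y (G q p) · Φ p l))
          ≈⟨ 𝕊R.+-cong {tail (y (E q))} 𝕊R.refl (tail-sum (λ p → y (G q p) · Φ p l)) ⟩
        tail (y (E q)) 𝕊R.+ sum (λ p → tail (y (G q p) · Φ p l))
          ≈⟨ 𝕊R.+-cong (𝕊R.trans (y-tail (E q))
                 (𝕊LP.lsum-concatMap (λ p → y (proj₁ p) · y (proj₂ p)) (λ s → contribution-E (δ q s)) S))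
               (𝕊R.trans (𝕊Σ.sum-cong-≋ tail-G)
                 (𝕊LP.sum-lsum (λ p s → value (contribution-G p (δ q s)) · Φ p l) S)) ⟩
        lsum (λ s → value (contribution-E (δ q s))) S
          𝕊R.+ lsum (λ s → sum (λ p → value (contribution-G p (δ q s)) · Φ p l)) S
          ≈⟨ 𝕊LP.lsum-+ (λ s → value (contribution-E (δ q s))) (λ s → sum (λ p → value (contribution-G p (δ q s)) · Φ p l)) S ⟨
        lsum (λ s → value (contribution-E (δ q s)) 𝕊R.+ sum (λ p → value (contribution-G p (δ q s)) · Φ p l)) S
          ≈⟨ 𝕊LP.lsum-cong (λ s → tail-EG (δ q s) l) S ⟩
        lsum (λ s → Φ′ (step (q , suc l) s)) S ∎
        where
        tail-G : ∀ p → tail (y (G q p) · Φ p l) ≋ lsum (λ s → value (contribution-G p (δ q s)) · Φ p l) S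
        tail-G p = begin
          tail (y (G q p) · Φ p l)
            -- A descent takes at least one step, so `G q p` has constant term 0 and the shift falls
            -- entirely on this factor.
            ≈⟨ (λ n → trans (cong (λ g → g * Φ p l (suc n) + (tail (y (G q p)) · Φ p l) n) (y-initial (G q p)))
                 (trans (cong (_+ (tail (y (G q p)) · Φ p l) n) (ℤₚ.*-zeroˡ (Φ p l (suc n)))) (ℤₚ.+-identityˡ _))) ⟩
          tail (y (G q p)) · Φ p l
            ≈⟨ 𝕊R.*-congʳ {Φ p l} (𝕊R.trans (y-tail (G q p))
                 (𝕊LP.lsum-concatMap (λ p → y (proj₁ p) · y (proj₂ p)) (λ s → contribution-G p (δ q s)) S)) ⟩
          lsum (λ s → value (contribution-G p (δ q s))) S · Φ p l
            ≈⟨ 𝕊LP.lsum-*ʳ (λ s → value (contribution-G p (δ q s))) (Φ p l) S ⟩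
          lsum (λ s → value (contribution-G p (δ q s)) · Φ p l) S ∎

      Φ-initial : ∀ q l → Φ q l 0 ≡ accept q
      Φ-initial q zero = y-initial (F q)
      Φ-initial q (suc l) = trans (cong₂ _+_ (y-initial (E q)) (sum-vanishes (λ p → y (G q p) · Φ p l)
          (λ p → trans (cong (_* Φ p l 0) (y-initial (G q p))) (ℤₚ.*-zeroˡ (Φ p l 0)))))
        (ℤₚ.+-identityʳ _)
        where
        sum-vanishes : ∀ {n} (f : Fin n → FPS) → (∀ p → f p 0 ≡ 0ℤ) → sum f 0 ≡ 0ℤ
        sum-vanishes {zero} f z = refl
        sum-vanishes {suc n} f z = trans (cong₂ _+_ (z zero) (sum-vanishes (f ∘ suc) (z ∘ suc))) (ℤₚ.+-identityˡ 0ℤ)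

      Φ≗run : ∀ n c → Φ′ c n ≡ run n c
      Φ≗run n nothing = refl
      Φ≗run zero (just (q , l)) = Φ-initial q l
      Φ≗run (suc n) (just c) = trans (tail-Φ c n) (pointwise S)
        where
        pointwise : ∀ ss → lsum (λ s → Φ′ (step c s)) ss n ≡ ℤL.lsum (λ s → run n (step c s)) ss
        pointwise [] = refl
        pointwise (s ∷ ss) = cong₂ _+_ (Φ≗run n (step c s)) (pointwise ss)

    run-algebraic : ∀ q → IsAlgebraic (λ n → run n (just (q , 0)))
    run-algebraic q = let Y , Y-initial , Y-tail , Y-algebraic = solution in
      IsAlgebraic-resp (λ n → Decomposition.Φ≗run Y Y-initial Y-tail n (just (q , 0))) (Y-algebraic (encode (F q)))

-- Periodicity and density of the members of a type.

module TypeGeometry where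
  open import Defs using (minL; maxL; sumset; times; bottomPrune; topPrune)
  open import Data.Nat as ℕ using (ℕ; zero; suc; z≤n; s≤s)
  import Data.Nat.Properties as ℕₚ
  open import Data.Integer as ℤ using (ℤ; +_; 0ℤ; 1ℤ; -1ℤ; _+_; _-_; -_; _≤_; ∣_∣; +≤+; _⊓_; _⊔_)
  import Data.Integer.Properties as ℤₚ
  open import Data.Integer.Tactic.RingSolver using (solve)
  open import Data.List as List using (List; []; _∷_; foldr; map)
  open import Data.List.Membership.Propositional using (_∈_; _∉_)
  open import Data.List.Membership.DecPropositional ℤ._≟_ using (_∈?_)
  open import Data.List.Membership.Propositional.Properties using (∈-map⁺; ∈-map⁻; ∈-filter⁺; ∈-filter⁻; ∈-concatMap⁺; ∈-concatMap⁻)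
  open import Data.List.Relation.Unary.Any as Any using (Any; here; there)
  open import Data.Product using (∃; _×_; _,_; proj₁)
  open import Data.Sum using (inj₁; inj₂)
  open import Data.Empty using (⊥; ⊥-elim)

  open import Relation.Nullary using (¬_; yes; no; contradiction; ¬?)
  open import Relation.Binary.PropositionalEquality using (_≡_; _≢_; refl; sym; trans; cong; subst)

  -- Linear inequalities are derived by adding up hypotheses and comparing differences.
  infixr 3 _⊞_
  _⊞_ : ∀ {a b c d} → a ≤ b → c ≤ d → a + c ≤ b + d
  _⊞_ = ℤₚ.+-mono-≤

  rearrange : ∀ {a b p q} → a ≤ b → b - a ≡ q - p → p ≤ q
  rearrange a≤b eq = ℤₚ.0≤i-j⇒j≤i (subst (0ℤ ≤_) eq (ℤₚ.i≤j⇒0≤j-i a≤b))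

  absurd : ∀ {a b} → a ≤ b → b - a ≡ -1ℤ → ⊥
  absurd a≤b eq with subst (0ℤ ≤_) eq (ℤₚ.i≤j⇒0≤j-i a≤b)
  ... | ()

  ≰⇒1+≤ : ∀ {a b} → ¬ a ≤ b → 1ℤ + b ≤ a
  ≰⇒1+≤ a≰b = ℤₚ.i<j⇒suc[i]≤j (ℤₚ.≰⇒> a≰b)

  -- Here and in `Dense`, `lo` and `hi` range over all points of R instead of its extreme points: no
  -- extremum has to be found, and an empty R needs no separate treatment.
  Periodic : ℕ → ℕ → (ℤ → Set) → Set
  Periodic N B R = ∀ lo hi x → R lo → R hi → lo + + B ≤ x → x + + N + + B ≤ hi →
    (R x → R (x + + N)) × (R (x + + N) → R x)

  Dense : ℕ → (ℤ → Set) → Set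
  Dense G R = ∀ lo hi z → R lo → R hi → 1ℤ + lo ≤ z → z ≤ hi → ∃ λ r → R r × z ≤ r × r ≤ z + + G

  magnitude : List ℤ → ℕ
  magnitude = foldr (λ x m → ∣ x ∣ ℕ.+ m) 0

  ∈⇒∣∣≤magnitude : ∀ {x} {s : List ℤ} → x ∈ s → ∣ x ∣ ℕ.≤ magnitude s
  ∈⇒∣∣≤magnitude (here refl) = ℕₚ.m≤m+n _ _
  ∈⇒∣∣≤magnitude {x} {y ∷ s} (there x∈) = ℕₚ.≤-trans (∈⇒∣∣≤magnitude x∈) (ℕₚ.m≤n+m _ ∣ y ∣)

  ∣∣≤⇒≤ : ∀ x {m} → ∣ x ∣ ℕ.≤ m → x ≤ + m
  ∣∣≤⇒≤ (+ k) p = +≤+ p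
  ∣∣≤⇒≤ ℤ.-[1+ k ] p = ℤ.-≤+

  ∣∣≤⇒-≤ : ∀ x {m} → ∣ x ∣ ℕ.≤ m → - + m ≤ x
  ∣∣≤⇒-≤ (+ k) p = ℤₚ.neg-≤-pos
  ∣∣≤⇒-≤ ℤ.-[1+ k ] p = ℤₚ.neg-mono-≤ (+≤+ p)

  minL-≤ : ∀ {x} s → x ∈ s → minL s ≤ x
  minL-≤ {x} (y ∷ s) x∈ = go s x∈
    where
    go : ∀ s → x ∈ y ∷ s → foldr _⊓_ y s ≤ x
    go [] (here refl) = ℤₚ.≤-refl
    go (z ∷ s) (here refl) = ℤₚ.≤-trans (ℤₚ.i⊓j≤j z (foldr _⊓_ y s)) (go s (here refl))
    go (z ∷ s) (there (here refl)) = ℤₚ.i⊓j≤i z (foldr _⊓_ y s)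
    go (z ∷ s) (there (there x∈)) = ℤₚ.≤-trans (ℤₚ.i⊓j≤j z (foldr _⊓_ y s)) (go s (there x∈))

  ≤-maxL : ∀ {x} s → x ∈ s → x ≤ maxL s
  ≤-maxL {x} (y ∷ s) x∈ = go s x∈
    where
    go : ∀ s → x ∈ y ∷ s → x ≤ foldr _⊔_ y s
    go [] (here refl) = ℤₚ.≤-refl
    go (z ∷ s) (here refl) = ℤₚ.≤-trans (go s (here refl)) (ℤₚ.i≤j⊔i z (foldr _⊔_ y s))
    go (z ∷ s) (there (here refl)) = ℤₚ.i≤i⊔j z (foldr _⊔_ y s)
    go (z ∷ s) (there (there x∈)) = ℤₚ.≤-trans (go s (there x∈)) (ℤₚ.i≤j⊔i z (foldr _⊔_ y s))

  minL-∈ : ∀ s → s ≢ [] → minL s ∈ s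
  minL-∈ [] s≢[] = contradiction refl s≢[]
  minL-∈ (y ∷ s) _ = go s
    where
    go : ∀ s → foldr _⊓_ y s ∈ y ∷ s
    go [] = here refl
    go (z ∷ s) with ℤₚ.⊓-sel z (foldr _⊓_ y s) | go s
    ... | inj₁ eq | _ = there (here eq)
    ... | inj₂ eq | here eq′ = here (trans eq eq′)
    ... | inj₂ eq | there p = there (there (subst (_∈ s) (sym eq) p))

  maxL-∈ : ∀ s → s ≢ [] → maxL s ∈ s
  maxL-∈ [] s≢[] = contradiction refl s≢[]
  maxL-∈ (y ∷ s) _ = go s
    where
    go : ∀ s → foldr _⊔_ y s ∈ y ∷ s
    go [] = here refl
    go (z ∷ s) with ℤₚ.⊔-sel z (foldr _⊔_ y s) | go s
    ... | inj₁ eq | _ = there (here eq)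
    ... | inj₂ eq | here eq′ = here (trans eq eq′)
    ... | inj₂ eq | there p = there (there (subst (_∈ s) (sym eq) p))

  ∈-sumset⁺ : ∀ {x y} s t → x ∈ s → y ∈ t → x + y ∈ sumset s t
  ∈-sumset⁺ s t x∈ y∈ = ∈-concatMap⁺ (λ a → map (λ z → a + z) t) (Any.map (λ where refl → ∈-map⁺ _ y∈) x∈)

  ∈-sumset⁻ : ∀ {z} s t → z ∈ sumset s t → ∃ λ x → ∃ λ y → x ∈ s × y ∈ t × z ≡ x + y
  ∈-sumset⁻ s t z∈ = go (∈-concatMap⁻ (λ a → map (λ z → a + z) t) z∈)
    where
    go : ∀ {z s} → Any (λ a → z ∈ map (λ y → a + y) t) s → ∃ λ x → ∃ λ y → x ∈ s × y ∈ t × z ≡ x + y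
    go (here p) = let y , y∈ , eq = ∈-map⁻ _ p in _ , y , here refl , y∈ , eq
    go (there p) = let x , y , x∈ , y∈ , eq = go p in x , y , there x∈ , y∈ , eq

  ∈-times⁺ : ∀ {n} j i → i ℕ.≤ j → + (i ℕ.* n) ∈ times j (0ℤ ∷ + n ∷ [])
  ∈-times⁺ zero zero _ = here refl
  ∈-times⁺ {n} (suc j) zero _ = ∈-sumset⁺ (0ℤ ∷ + n ∷ []) (times j _) (here refl) (∈-times⁺ {n} j zero z≤n)
  ∈-times⁺ {n} (suc j) (suc i) (s≤s i≤j) = ∈-sumset⁺ (0ℤ ∷ + n ∷ []) (times j _) (there (here refl)) (∈-times⁺ j i i≤j)

  ∈-times⁻ : ∀ {n x} j → x ∈ times j (0ℤ ∷ + n ∷ []) → ∃ λ i → i ℕ.≤ j × x ≡ + (i ℕ.* n)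
  ∈-times⁻ zero (here refl) = 0 , z≤n , refl
  ∈-times⁻ {n} (suc j) x∈ with ∈-sumset⁻ (0ℤ ∷ + n ∷ []) (times j _) x∈
  ... | _ , y , here refl , y∈ , refl = let i , i≤j , eq = ∈-times⁻ j y∈ in
    i , ℕₚ.m≤n⇒m≤1+n i≤j , trans (ℤₚ.+-identityˡ y) eq
  ... | _ , y , there (here refl) , y∈ , refl = let i , i≤j , eq = ∈-times⁻ j y∈ in
    suc i , s≤s i≤j , cong (λ z → + n + z) eq

  ∈-bottomPrune⁺ : ∀ {x} s t → x ∈ s → x ∉ map (λ b → minL s + b) t → x ∈ bottomPrune s t
  ∈-bottomPrune⁺ s@(_ ∷ _) t = ∈-filter⁺ (λ y → ¬? (y ∈? map (λ b → minL s + b) t))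

  ∈-bottomPrune⁻ : ∀ {x} s t → x ∈ bottomPrune s t → x ∈ s × x ∉ map (λ b → minL s + b) t
  ∈-bottomPrune⁻ s@(_ ∷ _) t = ∈-filter⁻ (λ y → ¬? (y ∈? map (λ b → minL s + b) t))

  ∈-topPrune⁺ : ∀ {x} s t → x ∈ s → x ∉ map (λ b → maxL s - b) t → x ∈ topPrune s t
  ∈-topPrune⁺ s@(_ ∷ _) t = ∈-filter⁺ (λ y → ¬? (y ∈? map (λ b → maxL s - b) t))

  ∈-topPrune⁻ : ∀ {x} s t → x ∈ topPrune s t → x ∈ s × x ∉ map (λ b → maxL s - b) t
  ∈-topPrune⁻ s@(_ ∷ _) t = ∈-filter⁻ (λ y → ¬? (y ∈? map (λ b → maxL s - b) t))

  module TypeStructure (n j : ℕ) (a b c : List ℤ) where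

    -- `K` bounds all elements of a, b and c in absolute value. `B` and `G` leave room for the
    -- prunings and for the spread of b; they do not depend on j and so are common to all members of
    -- a type.
    K B G : ℕ
    K = magnitude a ℕ.+ (magnitude b ℕ.+ magnitude c)
    B = suc (K ℕ.+ (K ℕ.+ K))
    G = suc (n ℕ.+ (K ℕ.+ (K ℕ.+ (K ℕ.+ K))))

    X Y Z : List ℤ
    X = sumset (times j (0ℤ ∷ + n ∷ [])) b
    Y = bottomPrune X a
    Z = topPrune Y c

    a≤K : ∀ {x} → x ∈ a → x ≤ + K
    a≤K x∈ = ∣∣≤⇒≤ _ (ℕₚ.≤-trans (∈⇒∣∣≤magnitude x∈) (ℕₚ.m≤m+n _ _))

    b≤K : ∀ {x} → x ∈ b → ∣ x ∣ ℕ.≤ K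
    b≤K x∈ = ℕₚ.≤-trans (∈⇒∣∣≤magnitude x∈) (ℕₚ.≤-trans (ℕₚ.m≤m+n _ (magnitude c)) (ℕₚ.m≤n+m _ (magnitude a)))

    c≤K : ∀ {x} → x ∈ c → x ≤ + K
    c≤K x∈ = ∣∣≤⇒≤ _ (ℕₚ.≤-trans (∈⇒∣∣≤magnitude x∈) (ℕₚ.≤-trans (ℕₚ.m≤n+m _ (magnitude b)) (ℕₚ.m≤n+m _ (magnitude a))))

    InX : ℤ → Set
    InX x = ∃ λ i → ∃ λ β → i ℕ.≤ j × β ∈ b × x ≡ + (i ℕ.* n) + β

    ∈X⇒InX : ∀ {x} → x ∈ X → InX x
    ∈X⇒InX x∈ =
      let y , β , y∈ , β∈ , eq = ∈-sumset⁻ (times j _) b x∈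
          i , i≤j , eq′ = ∈-times⁻ j y∈
      in i , β , i≤j , β∈ , trans eq (cong (_+ β) eq′)

    InX⇒∈X : ∀ {x} → InX x → x ∈ X
    InX⇒∈X (i , β , i≤j , β∈ , refl) = ∈-sumset⁺ (times j _) b (∈-times⁺ j i i≤j) β∈

    Z⇒X : ∀ {x} → x ∈ Z → x ∈ X
    Z⇒X x∈ = proj₁ (∈-bottomPrune⁻ X a (proj₁ (∈-topPrune⁻ Y c x∈)))

    lower : ∀ {x} → x ∈ Z → - + K ≤ x
    lower x∈ with ∈X⇒InX (Z⇒X x∈)
    ... | i , β , _ , β∈ , refl = rearrange (∣∣≤⇒-≤ β (b≤K β∈) ⊞ +≤+ (z≤n {i ℕ.* n})) (eq (+ (i ℕ.* n)) β (+ K))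
      where
      eq : ∀ ι β κ → (β + ι) - (- κ + 0ℤ) ≡ (ι + β) - (- κ)
      eq ι β κ = solve (ι ∷ β ∷ κ ∷ [])

    upper : ∀ {x} → x ∈ Z → x ≤ + (j ℕ.* n) + + K
    upper x∈ with ∈X⇒InX (Z⇒X x∈)
    ... | i , β , i≤j , β∈ , refl = +≤+ (ℕₚ.*-monoˡ-≤ n i≤j) ⊞ ∣∣≤⇒≤ β (b≤K β∈)

    -- The bottom pruning removes points at most K above min X ≤ lo, the top pruning points at most
    -- K below max Y ≥ hi; nothing strictly between these margins is touched.
    interior : ∀ {lo hi x} → lo ∈ Z → hi ∈ Z → InX x → 1ℤ + (lo + + K) ≤ x → 1ℤ + (x + + K) ≤ hi → x ∈ Z
    interior {lo} {hi} {x} lo∈ hi∈ x∈X lo<x x<hi =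
      ∈-topPrune⁺ Y c (∈-bottomPrune⁺ X a (InX⇒∈X x∈X) not-bottom) not-top
      where
      not-bottom : x ∉ map (λ b → minL X + b) a
      not-bottom x∈ = let α , α∈ , eq = ∈-map⁻ _ x∈ in
        absurd (lo<x ⊞ minL-≤ X (Z⇒X lo∈) ⊞ a≤K α∈ ⊞ ℤₚ.≤-reflexive eq) (cancel (+ K) α (minL X))
        where
        cancel : ∀ κ α μ → (x + (lo + (κ + (μ + α)))) - ((1ℤ + (lo + κ)) + (μ + (α + x))) ≡ -1ℤ
        cancel κ α μ = solve (x ∷ lo ∷ κ ∷ α ∷ μ ∷ [])

      not-top : x ∉ map (λ b → maxL Y - b) c
      not-top x∈ = let γ , γ∈ , eq = ∈-map⁻ _ x∈ in
        absurd (x<hi ⊞ ≤-maxL Y (proj₁ (∈-topPrune⁻ Y c hi∈)) ⊞ c≤K γ∈ ⊞ ℤₚ.≤-reflexive (sym eq)) (cancel (+ K) γ (maxL Y))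
        where
        cancel : ∀ κ γ μ → (hi + (μ + (κ + x))) - ((1ℤ + (x + κ)) + (hi + (γ + (μ - γ)))) ≡ -1ℤ
        cancel κ γ μ = solve (x ∷ hi ∷ κ ∷ γ ∷ μ ∷ [])

    0≤K : 0ℤ ≤ + K
    0≤K = +≤+ z≤n

    0≤n : 0ℤ ≤ + n
    0≤n = +≤+ z≤n

    periodic : Periodic n B (_∈ Z)
    periodic lo hi x lo∈ hi∈ lo≤x x≤hi = forth , back
      where
      forth : x ∈ Z → x + + n ∈ Z
      forth x∈ with ∈X⇒InX (Z⇒X x∈)
      ... | i , β , i≤j , β∈ , eq with ℕₚ.m≤n⇒m<n∨m≡n i≤j
      ... | inj₁ i<j = interior lo∈ hi∈ (suc i , β , i<j , β∈ , trans (cong (_+ + n) eq) (shuffle (+ (i ℕ.* n)) (+ n)))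
        (rearrange (lo≤x ⊞ 0≤K ⊞ 0≤K ⊞ 0≤n) (cancel (+ K) (+ n))) (rearrange (x≤hi ⊞ 0≤K ⊞ 0≤K) (cancel′ (+ K) (+ n)))
        where
        shuffle : ∀ ι ν → ι + β + ν ≡ ν + ι + β
        shuffle ι ν = solve (ι ∷ ν ∷ β ∷ [])
        cancel : ∀ κ ν → (x + (κ + (κ + ν))) - ((lo + (1ℤ + (κ + (κ + κ)))) + (0ℤ + (0ℤ + 0ℤ))) ≡ (x + ν) - (1ℤ + (lo + κ))
        cancel κ ν = solve (x ∷ lo ∷ κ ∷ ν ∷ [])
        cancel′ : ∀ κ ν → (hi + (κ + κ)) - ((x + ν + (1ℤ + (κ + (κ + κ)))) + (0ℤ + 0ℤ)) ≡ hi - (1ℤ + (x + ν + κ))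
        cancel′ κ ν = solve (x ∷ hi ∷ κ ∷ ν ∷ [])
      -- In the last translate of b, x is at least j n - K, whereas hi is at most j n + K: x + n
      -- cannot lie B below hi.
      ... | inj₂ refl = ⊥-elim
        (absurd (x≤hi ⊞ upper hi∈ ⊞ ∣∣≤⇒-≤ β (b≤K β∈) ⊞ ℤₚ.≤-reflexive (sym eq) ⊞ 0≤n ⊞ 0≤K) (cancel (+ K) (+ n) (+ (i ℕ.* n))))
        where
        cancel : ∀ κ ν ι → (hi + (ι + κ + (β + (x + (ν + κ))))) -
          ((x + ν + (1ℤ + (κ + (κ + κ)))) + (hi + (- κ + (ι + β + (0ℤ + 0ℤ))))) ≡ -1ℤ
        cancel κ ν ι = solve (x ∷ hi ∷ κ ∷ ν ∷ ι ∷ β ∷ [])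

      back : x + + n ∈ Z → x ∈ Z
      back x∈ with ∈X⇒InX (Z⇒X x∈)
      ... | suc i , β , i<j , β∈ , eq = interior lo∈ hi∈ (i , β , ℕₚ.<⇒≤ i<j , β∈ , unshift (+ (i ℕ.* n)) (+ n) eq)
        (rearrange (lo≤x ⊞ 0≤K ⊞ 0≤K) (cancel (+ K))) (rearrange (x≤hi ⊞ 0≤K ⊞ 0≤K ⊞ 0≤n) (cancel′ (+ K) (+ n)))
        where
        unshift : ∀ ι ν → x + ν ≡ ν + ι + β → x ≡ ι + β
        unshift ι ν eq = trans before (trans (cong (_- ν) eq) after)
          where
          before : x ≡ (x + ν) - ν
          before = solve (x ∷ ν ∷ [])
          after : (ν + ι + β) - ν ≡ ι + β
          after = solve (ι ∷ ν ∷ β ∷ [])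
        cancel : ∀ κ → (x + (κ + κ)) - ((lo + (1ℤ + (κ + (κ + κ)))) + (0ℤ + 0ℤ)) ≡ x - (1ℤ + (lo + κ))
        cancel κ = solve (x ∷ lo ∷ κ ∷ [])
        cancel′ : ∀ κ ν → (hi + (κ + (κ + ν))) - ((x + ν + (1ℤ + (κ + (κ + κ)))) + (0ℤ + (0ℤ + 0ℤ))) ≡ hi - (1ℤ + (x + κ))
        cancel′ κ ν = solve (x ∷ hi ∷ κ ∷ ν ∷ [])
      -- In the first translate of b, x + n is at most K, whereas lo + B is at least 2K + 1.
      ... | zero , β , _ , β∈ , eq = ⊥-elim
        (absurd (lo≤x ⊞ lower lo∈ ⊞ ∣∣≤⇒≤ β (b≤K β∈) ⊞ ℤₚ.≤-reflexive eq ⊞ 0≤n ⊞ 0≤K) (cancel (+ K) (+ n)))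
        where
        cancel : ∀ κ ν → (x + (lo + (κ + (0ℤ + β + (ν + κ))))) -
          ((lo + (1ℤ + (κ + (κ + κ)))) + (- κ + (β + (x + ν + (0ℤ + 0ℤ))))) ≡ -1ℤ
        cancel κ ν = solve (x ∷ lo ∷ κ ∷ ν ∷ β ∷ [])

    -- The progression i n + β starts at most 2K above u and has gaps n; the search descends to its
    -- first term that is not below u.
    hit : ∀ {β} u i → β ≤ u + + K + + K → u ≤ + (i ℕ.* n) + β →
      ∃ λ i′ → i′ ℕ.≤ i × u ≤ + (i′ ℕ.* n) + β × + (i′ ℕ.* n) + β ≤ u + + K + + K + + n
    hit {β} u zero β≤ u≤ = 0 , z≤n , u≤ , rearrange (β≤ ⊞ 0≤n) (cancel (+ K) (+ n))
      where
      cancel : ∀ κ ν → (u + κ + κ + ν) - (β + 0ℤ) ≡ (u + κ + κ + ν) - (0ℤ + β)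
      cancel κ ν = solve (u ∷ κ ∷ ν ∷ β ∷ [])
    hit {β} u (suc i) β≤ u≤ with u ℤ.≤? + (i ℕ.* n) + β
    ... | yes u≤′ = let i′ , i′≤i , p = hit u i β≤ u≤′ in i′ , ℕₚ.m≤n⇒m≤1+n i′≤i , p
    ... | no u≰ = suc i , ℕₚ.≤-refl , u≤ ,
      rearrange (≰⇒1+≤ u≰ ⊞ 0≤K ⊞ 0≤K ⊞ +≤+ (z≤n {1})) (cancel (+ K) (+ n) (+ (i ℕ.* n)))
      where
      cancel : ∀ κ ν ι → (u + (κ + (κ + 1ℤ))) - ((1ℤ + (ι + β)) + (0ℤ + (0ℤ + 0ℤ))) ≡ (u + κ + κ + ν) - (ν + ι + β)
      cancel κ ν ι = solve (u ∷ κ ∷ ν ∷ ι ∷ β ∷ [])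

    -- A single β suffices. Searching from z + K clears the bottom pruning, and hi > z + G leaves
    -- the margin for the top pruning; if hi is closer than that, hi itself is taken.
    dense : Dense G (_∈ Z)
    dense lo hi z lo∈ hi∈ lo<z z≤hi with hi ℤ.≤? z + + G
    ... | yes hi≤ = hi , hi∈ , z≤hi , hi≤
    -- Any member of Z yields an element β of b.
    ... | no hi≰ with ∈X⇒InX (Z⇒X lo∈)
    ... | _ , β , _ , β∈ , _ =
      let i , i≤j , u≤ , ≤u = hit {β} (z + + K) j
            (rearrange (∣∣≤⇒≤ β (b≤K β∈) ⊞ lower lo∈ ⊞ lo<z ⊞ 0≤K ⊞ 0≤1) (cancel₁ (+ K)))
            (rearrange (≰⇒1+≤ hi≰ ⊞ upper hi∈ ⊞ ∣∣≤⇒-≤ β (b≤K β∈) ⊞ 0≤n ⊞ 0≤K ⊞ 0≤1 ⊞ 0≤1) (cancel₂ (+ K) (+ n) (+ (j ℕ.* n))))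
      in + (i ℕ.* n) + β ,
         interior lo∈ hi∈ (i , β , i≤j , β∈ , refl)
           (rearrange (lo<z ⊞ u≤) (cancel₃ (+ K) (+ (i ℕ.* n))))
           (rearrange (≰⇒1+≤ hi≰ ⊞ ≤u ⊞ 0≤1) (cancel₄ (+ K) (+ n) (+ (i ℕ.* n)))) ,
         rearrange (u≤ ⊞ 0≤K) (cancel₅ (+ K) (+ (i ℕ.* n))) ,
         rearrange (≤u ⊞ 0≤K ⊞ 0≤1) (cancel₆ (+ K) (+ n) (+ (i ℕ.* n)))
      where
      0≤1 : 0ℤ ≤ 1ℤ
      0≤1 = +≤+ z≤n
      cancel₁ : ∀ κ → (κ + (lo + (z + (κ + 1ℤ)))) - (β + (- κ + (1ℤ + lo + (0ℤ + 0ℤ)))) ≡ (z + κ + κ + κ) - β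
      cancel₁ κ = solve (z ∷ lo ∷ κ ∷ β ∷ [])
      cancel₂ : ∀ κ ν ι → (hi + (ι + κ + (β + (ν + (κ + (1ℤ + 1ℤ)))))) -
        ((1ℤ + (z + (1ℤ + (ν + (κ + (κ + (κ + κ))))))) + (hi + (- κ + (0ℤ + (0ℤ + (0ℤ + 0ℤ)))))) ≡ (ι + β) - (z + κ)
      cancel₂ κ ν ι = solve (z ∷ hi ∷ κ ∷ ν ∷ ι ∷ β ∷ [])
      cancel₃ : ∀ κ ι → (z + (ι + β)) - ((1ℤ + lo) + (z + κ)) ≡ (ι + β) - (1ℤ + (lo + κ))
      cancel₃ κ ι = solve (z ∷ lo ∷ κ ∷ ι ∷ β ∷ [])
      cancel₄ : ∀ κ ν ι → (hi + (z + κ + κ + κ + ν + 1ℤ)) - ((1ℤ + (z + (1ℤ + (ν + (κ + (κ + (κ + κ))))))) + (ι + β + 0ℤ)) ≡ hi - (1ℤ + (ι + β + κ))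
      cancel₄ κ ν ι = solve (z ∷ hi ∷ κ ∷ ν ∷ ι ∷ β ∷ [])
      cancel₅ : ∀ κ ι → (ι + β + κ) - (z + κ + 0ℤ) ≡ (ι + β) - z
      cancel₅ κ ι = solve (z ∷ κ ∷ ι ∷ β ∷ [])
      cancel₆ : ∀ κ ν ι → (z + κ + κ + κ + ν + (κ + 1ℤ)) - (ι + β + (0ℤ + 0ℤ)) ≡ (z + (1ℤ + (ν + (κ + (κ + (κ + κ)))))) - (ι + β)
      cancel₆ κ ν ι = solve (z ∷ κ ∷ ν ∷ ι ∷ β ∷ [])

-- Common constants for finitely many types.

module UniformStructure where
  open import Defs using (TypeParams; InType; typeMember)
  open TypeGeometry
  open import Data.Nat as ℕ using (ℕ; zero; suc; z≤n; s≤s)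
  import Data.Nat.Properties as ℕₚ
  open import Data.Integer using (ℤ; +_; 0ℤ; 1ℤ; -1ℤ; _+_; _-_; -_; _≤_; +≤+)
  import Data.Integer.Properties as ℤₚ
  open import Data.Integer.Tactic.RingSolver using (solve)
  open import Data.List using (List; []; _∷_)
  open import Data.List.Membership.Propositional using (_∈_)
  open import Data.List.Membership.Propositional.Properties using (∈-map⁺; ∈-map⁻)
  open import Data.List.Relation.Unary.Any using (Any; here; there)
  open import Data.Product using (∃; _×_; _,_; proj₁; proj₂)
  open import Data.Empty using (⊥-elim)
  open import Function using (_∘_)
  open import Function.Bundles using (_⇔_; Equivalence)
  open import Relation.Binary.PropositionalEquality using (_≡_; refl; sym; trans; cong; subst)

  Periodic-widen : ∀ {N B B′ R} → B ℕ.≤ B′ → Periodic N B R → Periodic N B′ R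
  Periodic-widen {N} {B} {B′} B≤B′ p lo hi x lo∈ hi∈ lo≤x x≤hi = p lo hi x lo∈ hi∈
    (ℤₚ.≤-trans (ℤₚ.+-monoʳ-≤ lo (+≤+ B≤B′)) lo≤x) (ℤₚ.≤-trans (ℤₚ.+-monoʳ-≤ (x + + N) (+≤+ B≤B′)) x≤hi)

  Dense-widen : ∀ {G G′ R} → G ℕ.≤ G′ → Dense G R → Dense G′ R
  Dense-widen G≤G′ d lo hi z lo∈ hi∈ lo<z z≤hi =
    let r , r∈ , z≤r , r≤ = d lo hi z lo∈ hi∈ lo<z z≤hi in
    r , r∈ , z≤r , ℤₚ.≤-trans r≤ (ℤₚ.+-monoʳ-≤ z (+≤+ G≤G′))

  Periodic-multiple : ∀ {N B R} k → Periodic N B R → Periodic (k ℕ.* N) B R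
  Periodic-multiple {R = R} zero p _ _ x _ _ _ _ = subst R (sym (ℤₚ.+-identityʳ x)) , subst R (ℤₚ.+-identityʳ x)
  Periodic-multiple {N} {B} {R} (suc k) p lo hi x lo∈ hi∈ lo≤x x≤hi =
    let forth , back = p lo hi x lo∈ hi∈ lo≤x (rearrange (x≤hi ⊞ 0≤kN) (drop (+ N) (+ (k ℕ.* N)) (+ B)))
        forth′ , back′ = Periodic-multiple k p lo hi (x + + N) lo∈ hi∈
          (rearrange (lo≤x ⊞ 0≤N) (raise (+ N) (+ B))) (subst (λ y → y + + B ≤ hi) (sym (ℤₚ.+-assoc x (+ N) _)) x≤hi)
    in subst R (ℤₚ.+-assoc x (+ N) _) ∘ forth′ ∘ forth , back ∘ back′ ∘ subst R (sym (ℤₚ.+-assoc x (+ N) _))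
    where
    0≤kN : 0ℤ ≤ + (k ℕ.* N)
    0≤kN = +≤+ z≤n
    0≤N : 0ℤ ≤ + N
    0≤N = +≤+ z≤n
    drop : ∀ ν ξ β → (hi + ξ) - ((x + (ν + ξ) + β) + 0ℤ) ≡ hi - (x + ν + β)
    drop ν ξ β = solve (hi ∷ ξ ∷ x ∷ ν ∷ β ∷ [])
    raise : ∀ ν β → (x + ν) - ((lo + β) + 0ℤ) ≡ (x + ν) - (lo + β)
    raise ν β = solve (lo ∷ x ∷ ν ∷ β ∷ [])

  -- For n = 0 every member of the type has diameter less than 2B, so that any period will do.
  period : ℕ → ℕ
  period zero = 1
  period (suc n) = suc n

  period>0 : ∀ n → 1 ℕ.≤ period n
  period>0 zero = s≤s z≤n
  period>0 (suc n) = s≤s z≤n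

  module _ (n : ℕ) (a b c : List ℤ) {R : ℤ → Set} (m : ℤ) (j : ℕ) (R⇔ : ∀ x → R x ⇔ (x ∈ typeMember n j a b c m)) where
    open TypeStructure n j a b c

    private
      centred : ∀ {x} → R x → x - m ∈ Z
      centred {x} Rx =
        let y , y∈ , eq = ∈-map⁻ (λ z → z + m) (Equivalence.to (R⇔ x) Rx) in
        subst (_∈ Z) (trans (cancel y) (cong (_- m) (sym eq))) y∈
        where
        cancel : ∀ y → y ≡ (y + m) - m
        cancel y = solve (y ∷ m ∷ [])

      uncentred : ∀ {x} → x - m ∈ Z → R x
      uncentred {x} x∈ = Equivalence.from (R⇔ x) (subst (_∈ typeMember n j a b c m) cancel (∈-map⁺ (λ z → z + m) x∈))
        where
        cancel : (x - m) + m ≡ x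
        cancel = solve (x ∷ m ∷ [])

      periodic-n : Periodic n B R
      periodic-n lo hi x lo∈ hi∈ lo≤x x≤hi =
        let forth , back = periodic (lo - m) (hi - m) (x - m) (centred lo∈) (centred hi∈)
              (rearrange lo≤x (left (+ B))) (rearrange x≤hi (right (+ n) (+ B)))
        in uncentred ∘ subst (_∈ Z) (swap (+ n)) ∘ forth ∘ centred ,
           uncentred ∘ back ∘ subst (_∈ Z) (sym (swap (+ n))) ∘ centred
        where
        left : ∀ β → x - (lo + β) ≡ (x - m) - (lo - m + β)
        left β = solve (x ∷ m ∷ lo ∷ β ∷ [])
        right : ∀ ν β → hi - (x + ν + β) ≡ (hi - m) - (x - m + ν + β)
        right ν β = solve (x ∷ m ∷ hi ∷ ν ∷ β ∷ [])
        swap : ∀ ν → (x - m) + ν ≡ (x + ν) - m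
        swap ν = solve (x ∷ m ∷ ν ∷ [])

    private
      -- `n` is fixed by the enclosing module, so the case distinction is made on a number equal to
      -- it.
      periodic-cases : ∀ n′ → n ≡ n′ → Periodic (period n′) B R
      periodic-cases (suc n′) n≡ = subst (λ p → Periodic p B R) n≡ periodic-n
      periodic-cases zero n≡ lo hi x lo∈ hi∈ lo≤x x≤hi =
        ⊥-elim (absurd (lo≤x ⊞ x≤hi ⊞ lower (centred lo∈) ⊞ upper′ (centred hi∈) ⊞ +≤+ (z≤n {K}) ⊞ +≤+ (z≤n {K}) ⊞ +≤+ (z≤n {K}) ⊞ +≤+ (z≤n {K}) ⊞ 0≤1 ⊞ 0≤1)
          (cancel x lo hi (+ K)))
        where
        0≤1 : 0ℤ ≤ 1ℤ
        0≤1 = +≤+ z≤n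
        upper′ : ∀ {x} → x ∈ Z → x ≤ + K
        upper′ {x} x∈ = ℤₚ.≤-trans (upper x∈) (ℤₚ.≤-reflexive
          (cong (λ i → + i + + K) (trans (cong (j ℕ.*_) n≡) (ℕₚ.*-zeroʳ j))))
        cancel : ∀ x lo hi κ →
          (x + (hi + (lo - m + (κ + (κ + (κ + (κ + (κ + (1ℤ + 1ℤ))))))))) -
          (lo + (1ℤ + (κ + (κ + κ))) + (x + 1ℤ + (1ℤ + (κ + (κ + κ))) + (- κ + (hi - m + (0ℤ + (0ℤ + (0ℤ + (0ℤ + (0ℤ + 0ℤ))))))))) ≡ -1ℤ
        cancel x lo hi κ = solve (x ∷ lo ∷ hi ∷ m ∷ κ ∷ [])

    inType-periodic : Periodic (period n) B R
    inType-periodic = periodic-cases n refl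

    inType-dense : Dense G R
    inType-dense lo hi z lo∈ hi∈ lo<z z≤hi =
      let r , r∈ , z≤r , r≤ = dense (lo - m) (hi - m) (z - m) (centred lo∈) (centred hi∈) (rearrange lo<z left) (rearrange z≤hi right)
      in r + m , uncentred (subst (_∈ Z) (cancel r) r∈) , rearrange z≤r (low r) , rearrange r≤ (high r (+ G))
      where
      left : z - (1ℤ + lo) ≡ (z - m) - (1ℤ + (lo - m))
      left = solve (z ∷ lo ∷ m ∷ [])
      right : hi - z ≡ (hi - m) - (z - m)
      right = solve (z ∷ hi ∷ m ∷ [])
      cancel : ∀ r → r ≡ (r + m) - m
      cancel r = solve (r ∷ m ∷ [])
      low : ∀ r → r - (z - m) ≡ (r + m) - z
      low r = solve (r ∷ z ∷ m ∷ [])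
      high : ∀ r γ → (z - m + γ) - r ≡ (z + γ) - (r + m)
      high r γ = solve (r ∷ z ∷ γ ∷ m ∷ [])

  -- Periods are multiplied, to obtain a common multiple; margins and gaps are added, to dominate
  -- each of them.
  uniform-structure : ∀ (types : List TypeParams) → ∃ λ N → ∃ λ B → ∃ λ G → 1 ℕ.≤ N ×
    (∀ {R} → Any (InType R) types → Periodic N B R × Dense G R)
  uniform-structure [] = 1 , 0 , 0 , s≤s z≤n , λ ()
  uniform-structure ((n , k , a , b , c) ∷ types) =
    let N , B , G , N>0 , structure = uniform-structure types
        -- The constants do not depend on j, so j = 0 stands for every j.
        module T = TypeStructure n 0 a b c
    in period n ℕ.* N , T.B ℕ.+ B , T.G ℕ.+ G , ℕₚ.*-mono-≤ (period>0 n) N>0 , λ {R} → λ where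
      (here (m , j , _ , R⇔)) →
        Periodic-widen (ℕₚ.m≤m+n T.B B) (subst (λ M → Periodic M T.B R) (ℕₚ.*-comm N (period n))
          (Periodic-multiple N (inType-periodic n a b c m j R⇔))) ,
        Dense-widen (ℕₚ.m≤m+n T.G G) (inType-dense n a b c m j R⇔)
      (there inType) →
        Periodic-widen (ℕₚ.m≤n+m B T.B) (Periodic-multiple (period n) (proj₁ (structure inType))) ,
        Dense-widen (ℕₚ.m≤n+m G T.G) (proj₂ (structure inType))

-- Reachable sets and their evolution under a step.

module ReachableSets where
  open import Defs
  open TypeGeometry
  open import Data.Bool using (Bool; _∧_; _∨_; T)
  open import Data.Bool.Properties using (T-∧)
  open import Data.Nat as ℕ using (ℕ; z≤n)
  open import Data.Integer as ℤ using (ℤ; +_; 0ℤ; 1ℤ; _+_; _-_; -_; _≤_; +≤+; ∣_∣)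
  import Data.Integer.Properties as ℤₚ
  open import Data.Integer.Tactic.RingSolver using (solve)
  open import Data.Bool.ListAction using (any)
  open import Data.List as List using (List; []; _∷_; foldl)
  open import Data.List.Membership.Propositional using (_∈_; find; lose)
  open import Data.List.Relation.Unary.All as All using (All)
  open import Data.List.Relation.Unary.Any using (Any; here; there)
  open import Data.List.Relation.Unary.Any.Properties using (any⁺; any⁻)
  open import Data.List.Relation.Binary.Pointwise as Pointwise using (Pointwise)
  open import Data.Product using (∃; _×_; _,_; proj₁)

  open import Function using (_∘_)
  open import Function.Bundles using (_⇔_; Equivalence; mk⇔)
  open import Relation.Nullary using (yes; no; ¬_)
  open import Relation.Nullary.Decidable using (⌊_⌋; toWitness; fromWitness)
  open import Relation.Binary.PropositionalEquality using (_≡_; refl; sym; trans; cong; cong₂; subst)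

  i≡i+j-j : ∀ i j → i ≡ (i + j) - j
  i≡i+j-j i j = solve (i ∷ j ∷ [])

  i-j+j≡i : ∀ i j → (i - j) + j ≡ i
  i-j+j≡i i j = solve (i ∷ j ∷ [])

  -- Boolean characteristic functions: a step is computed pointwise, and agreement of two sets at a
  -- point is an equation, as the copying of entries into windows requires.
  PointSet : Set
  PointSet = ℤ → Bool

  ⟪_⟫ : PointSet → ℤ → Set
  ⟪ R ⟫ x = T (R x)

  origin : PointSet
  origin x = ⌊ x ℤ.≟ 0ℤ ⌋

  after : PointSet → List ℤ → PointSet
  after R s y = ⌊ 0ℤ ℤ.≤? y ⌋ ∧ any (λ v → R (y - v)) s

  after⁺ : ∀ R s {y v} → 0ℤ ≤ y → v ∈ s → ⟪ R ⟫ (y - v) → ⟪ after R s ⟫ y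
  after⁺ R s 0≤y v∈ p = Equivalence.from T-∧ (fromWitness 0≤y , any⁺ _ (lose v∈ p))

  after⁻ : ∀ R s {y} → ⟪ after R s ⟫ y → 0ℤ ≤ y × ∃ λ v → v ∈ s × ⟪ R ⟫ (y - v)
  after⁻ R s {y} p =
    let 0≤y , q = Equivalence.to T-∧ p
    in toWitness 0≤y , find (any⁻ (λ v → R (y - v)) s q)

  any-cong : ∀ {f g : ℤ → Bool} s → (∀ v → v ∈ s → f v ≡ g v) → any f s ≡ any g s
  any-cong [] h = refl
  any-cong (v ∷ s) h = cong₂ _∨_ (h v (here refl)) (any-cong s (λ u u∈ → h u (there u∈)))

  after-cong : ∀ R R′ s y → (∀ v → v ∈ s → R (y - v) ≡ R′ (y - v)) → after R s y ≡ after R′ s y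
  after-cong R R′ s y h = cong (⌊ 0ℤ ℤ.≤? y ⌋ ∧_) (any-cong s h)

  reach : List (List ℤ) → PointSet
  reach = foldl after origin

  -- Stated for any starting set R and position h, so that the induction can absorb the first step
  -- into them.
  foldl-after⁺ : ∀ R w {h} vs → ⟪ R ⟫ h → Compatible vs w → All (0ℤ ≤_) (positionsFrom h vs) →
    ⟪ foldl after R w ⟫ (h + endpoint vs)
  foldl-after⁺ R [] {h} [] Rh Pointwise.[] All.[] = subst ⟪ R ⟫ (sym (ℤₚ.+-identityʳ h)) Rh
  foldl-after⁺ R (s ∷ w) {h} (v ∷ vs) Rh (v∈ Pointwise.∷ compatible) (0≤ All.∷ nonneg) =
    subst ⟪ foldl after (after R s) w ⟫ (ℤₚ.+-assoc h v (endpoint vs))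
      (foldl-after⁺ (after R s) w vs (after⁺ R s 0≤ v∈ (subst ⟪ R ⟫ (i≡i+j-j h v) Rh)) compatible nonneg)

  foldl-after⁻ : ∀ R w {x} → ⟪ foldl after R w ⟫ x → ∃ λ h → ⟪ R ⟫ h × ∃ λ vs →
    Compatible vs w × All (0ℤ ≤_) (positionsFrom h vs) × h + endpoint vs ≡ x
  foldl-after⁻ R [] {x} Rx = x , Rx , [] , Pointwise.[] , All.[] , ℤₚ.+-identityʳ x
  foldl-after⁻ R (s ∷ w) {x} p with foldl-after⁻ (after R s) w p
  ... | h , q , vs , compatible , nonneg , eq with after⁻ R s q
  ... | 0≤h , v , v∈ , Rh = h - v , Rh , v ∷ vs , v∈ Pointwise.∷ compatible ,
    subst (λ y → All (0ℤ ≤_) (y ∷ positionsFrom y vs)) (sym (i-j+j≡i h v)) (0≤h All.∷ nonneg) ,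
    trans (trans (sym (ℤₚ.+-assoc (h - v) v (endpoint vs))) (cong (λ k → k + endpoint vs) (i-j+j≡i h v))) eq

  reach⇔Reachable : ∀ w x → ⟪ reach w ⟫ x ⇔ Reachable w x
  reach⇔Reachable w x = mk⇔ to from
    where
    to : ⟪ reach w ⟫ x → Reachable w x
    to p with foldl-after⁻ origin w p
    ... | h , h≡0 , vs , compatible , nonneg , eq with refl ← toWitness h≡0 =
      vs , compatible , nonneg , trans (sym (ℤₚ.+-identityˡ _)) eq
    from : Reachable w x → ⟪ reach w ⟫ x
    from (vs , compatible , nonneg , eq) = subst ⟪ reach w ⟫ (trans (ℤₚ.+-identityˡ _) eq)
      (foldl-after⁺ origin w vs (fromWitness {a? = 0ℤ ℤ.≟ 0ℤ} refl) compatible nonneg)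

  -- `low` asks for some point up to H, not for the least one: such a point can serve as `lo` in
  -- `Periodic` and `Dense`.
  record Profile (H : ℕ) (R : PointSet) (L : ℤ) : Set where
    field
      nonneg : ∀ {x} → ⟪ R ⟫ x → 0ℤ ≤ x
      peak   : ⟪ R ⟫ L
      above  : ∀ {x} → ⟪ R ⟫ x → x ≤ L
      low    : ∃ λ r → ⟪ R ⟫ r × r ≤ + H

  profile-origin : ∀ {H} → Profile H origin 0ℤ
  profile-origin = record
    { nonneg = λ p → ℤₚ.≤-reflexive (sym (toWitness p))
    ; peak = _
    ; above = λ p → ℤₚ.≤-reflexive (toWitness p)
    ; low = 0ℤ , _ , +≤+ z≤n }

  module StepProfile {R : PointSet} {L : ℤ} {G D : ℕ} (dense : Dense G ⟪ R ⟫) {s : List ℤ}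
    (s≢[] : ¬ s ≡ []) (∣s∣≤D : ∀ {v} → v ∈ s → ∣ v ∣ ℕ.≤ D) (min≤0 : minL s ≤ 0ℤ)
    (profile : Profile (G ℕ.+ (D ℕ.+ D)) R L) where
    open Profile profile

    after-above : ∀ {x} → ⟪ after R s ⟫ x → x ≤ L + maxL s
    after-above {x} p = let _ , v , v∈ , Rxv = after⁻ R s p in
      subst (_≤ L + maxL s) (i-j+j≡i x v) (above Rxv ⊞ ≤-maxL s v∈)

    -- The bound G + 2D is invariant: the old low point moves down by min s ≤ 0, or density gives a
    -- landing point up to G, or the new maximum is itself small.
    profile-after : 0ℤ ≤ L + maxL s → Profile (G ℕ.+ (D ℕ.+ D)) (after R s) (L + maxL s)
    profile-after 0≤L′ = record
      { nonneg = proj₁ ∘ after⁻ R s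
      ; peak = after⁺ R s 0≤L′ (maxL-∈ s s≢[]) (subst ⟪ R ⟫ (i≡i+j-j L (maxL s)) peak)
      ; above = after-above
      ; low = low′ }
      where
      μ : ℤ
      μ = minL s

      μ∈ : μ ∈ s
      μ∈ = minL-∈ s s≢[]

      land : ∀ {r} → ⟪ R ⟫ r → 0ℤ ≤ r + μ → ⟪ after R s ⟫ (r + μ)
      land {r} Rr 0≤ = after⁺ R s 0≤ μ∈ (subst ⟪ R ⟫ (i≡i+j-j r μ) Rr)

      -- Use the step min s from the first point where it is allowed; density bounds how far that point is.
      low′ : ∃ λ r → ⟪ after R s ⟫ r × r ≤ + (G ℕ.+ (D ℕ.+ D))
      low′ with low
      ... | r , Rr , r≤H with 0ℤ ℤ.≤? r + μ
      ... | yes 0≤ = r + μ , land Rr 0≤ , rearrange (r≤H ⊞ min≤0) (same (+ (G ℕ.+ (D ℕ.+ D))) (minL s) r)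
        where
        same : ∀ H μ r → (H + 0ℤ) - (r + μ) ≡ H - (r + μ)
        same H μ r = solve (H ∷ μ ∷ r ∷ [])
      ... | no r+μ≱0 with - μ ℤ.≤? L
      ... | yes -μ≤L = let r′ , Rr′ , -μ≤r′ , r′≤ = dense r L (- μ) Rr peak (rearrange (≰⇒1+≤ r+μ≱0) (before r μ)) -μ≤L in
        r′ + μ , land Rr′ (rearrange -μ≤r′ (shift r′ μ)) ,
        rearrange (r′≤ ⊞ +≤+ (z≤n {D ℕ.+ D})) (gap r′ μ (+ G) (+ (D ℕ.+ D)))
        where
        before : ∀ r μ → 0ℤ - (1ℤ + (r + μ)) ≡ (- μ) - (1ℤ + r)
        before r μ = solve (r ∷ μ ∷ [])
        shift : ∀ r μ → r - (- μ) ≡ (r + μ) - 0ℤ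
        shift r μ = solve (r ∷ μ ∷ [])
        gap : ∀ r μ γ δ → (- μ + γ + δ) - (r + 0ℤ) ≡ (γ + δ) - (r + μ)
        gap r μ γ δ = solve (r ∷ μ ∷ γ ∷ δ ∷ [])
      -- Here L < - min s ≤ D and max s ≤ D, so the new maximum is below 2D.
      ... | no -μ≰L = L + maxL s , after⁺ R s 0≤L′ (maxL-∈ s s≢[]) (subst ⟪ R ⟫ (i≡i+j-j L (maxL s)) peak) ,
        rearrange (≰⇒1+≤ -μ≰L ⊞ ∣∣≤⇒≤ (maxL s) (∣s∣≤D (maxL-∈ s s≢[])) ⊞ ∣∣≤⇒-≤ μ (∣s∣≤D μ∈) ⊞ +≤+ (z≤n {G}) ⊞ +≤+ (z≤n {1}))
          (tall L (maxL s) μ (+ D) (+ G))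
        where
        tall : ∀ L ξ μ δ γ → (- μ + (δ + (μ + (γ + 1ℤ)))) - (1ℤ + L + (ξ + (- δ + (0ℤ + 0ℤ)))) ≡ (γ + (δ + δ)) - (L + ξ)
        tall L ξ μ δ γ = solve (L ∷ ξ ∷ μ ∷ δ ∷ γ ∷ [])

-- Encoding of reachable sets by a finite state and a counter.

module ProfileCodes where
  open import Defs using (minL; maxL)
  open CubicElimination using (pack; unpack; unpack-pack)
  open CounterAutomata
  open TypeGeometry
  open ReachableSets
  open import Data.Bool using (Bool; true; false; T; if_then_else_)
  open import Data.Bool.ListAction using (any)
  open import Data.Nat as ℕ using (ℕ; zero; suc; z≤n; s≤s; _^_)
  import Data.Nat.Properties as ℕₚ
  open import Data.Fin as Fin using (Fin; zero; suc; toℕ; fromℕ<; combine; remQuot)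
  open import Data.Fin.Properties using (remQuot-combine; toℕ-fromℕ<; toℕ<n)
  open import Data.Integer as ℤ using (ℤ; +_; -[1+_]; 0ℤ; 1ℤ; -1ℤ; _+_; _-_; -_; _≤_; _<_; +≤+; ∣_∣)
  import Data.Integer.Properties as ℤₚ
  open import Data.Integer.Tactic.RingSolver using (solve)
  open import Data.List as List using (List; []; _∷_)
  open import Data.List.Membership.Propositional using (_∈_)
  open import Data.Maybe using (Maybe; just; nothing)
  open import Data.Product as Product using (_×_; _,_; proj₁; proj₂)
  open import Data.Empty using (⊥; ⊥-elim)
  open import Function using (_∘_)
  open import Relation.Nullary using (yes; no; ¬_)
  open import Relation.Nullary.Decidable using (⌊_⌋)
  open import Relation.Binary.PropositionalEquality using (_≡_; refl; sym; trans; cong; subst)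

  bit : Bool → Fin 2
  bit false = zero
  bit true = suc zero

  unbit : Fin 2 → Bool
  unbit zero = false
  unbit (suc zero) = true

  unbit-bit : ∀ b → unbit (bit b) ≡ b
  unbit-bit false = refl
  unbit-bit true = refl

  encodeBits : ∀ C → (ℕ → Bool) → Fin (2 ^ C)
  encodeBits zero f = zero
  encodeBits (suc C) f = combine (bit (f 0)) (encodeBits C (f ∘ suc))

  decodeBits : ∀ C → Fin (2 ^ C) → ℕ → Bool
  decodeBits zero k i = false
  decodeBits (suc C) k zero = unbit (proj₁ (remQuot {2} (2 ^ C) k))
  decodeBits (suc C) k (suc i) = decodeBits C (proj₂ (remQuot {2} (2 ^ C) k)) i

  decode-encodeBits : ∀ C f {i} → i ℕ.< C → decodeBits C (encodeBits C f) i ≡ f i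
  decode-encodeBits (suc C) f {zero} _ = trans
    (cong (unbit ∘ proj₁) (remQuot-combine (bit (f 0)) (encodeBits C (f ∘ suc)))) (unbit-bit (f 0))
  decode-encodeBits (suc C) f {suc i} (s≤s i<C) = trans
    (cong (λ k → decodeBits C (proj₂ k) i) (remQuot-combine (bit (f 0)) (encodeBits C (f ∘ suc))))
    (decode-encodeBits C (f ∘ suc) i<C)

  -- A profile with largest element L = l W + ρ is stored as its lowest C and its highest C entries, together with ρ;
  -- l is the counter. Since W = 2C, these entries determine the set when l = 0. When l > 0 the lowest entries after a step
  -- are found with the help of periodicity.
  module Code (C W′ : ℕ) where

    W m : ℕ
    W = suc W′
    m = 2 ^ C ℕ.* (2 ^ C ℕ.* W)

    -- The value false at negative indices is right for both windows: the set has no points below 0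
    -- and, counted downwards, none above its maximum.
    window : Fin (2 ^ C) → PointSet
    window k (+ i) = decodeBits C k i
    window k -[1+ i ] = false

    bottom top : Fin m → PointSet
    bottom q = window (proj₁ (unpack (2 ^ C) (2 ^ C) W q))
    top q = window (proj₁ (proj₂ (unpack (2 ^ C) (2 ^ C) W q)))

    residue : Fin m → Fin W
    residue q = proj₂ (proj₂ (unpack (2 ^ C) (2 ^ C) W q))

    code : PointSet → PointSet → Fin W → Fin m
    code β τ ρ = pack (encodeBits C (β ∘ +_) , encodeBits C (τ ∘ +_) , ρ)

    bottom-code : ∀ β τ ρ {i} → i ℕ.< C → bottom (code β τ ρ) (+ i) ≡ β (+ i)
    bottom-code β τ ρ {i} i<C = trans
      (cong (λ p → window (proj₁ p) (+ i)) (unpack-pack {2 ^ C} {2 ^ C} {W} (encodeBits C (β ∘ +_) , encodeBits C (τ ∘ +_) , ρ)))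
      (decode-encodeBits C (β ∘ +_) i<C)

    top-code : ∀ β τ ρ {i} → i ℕ.< C → top (code β τ ρ) (+ i) ≡ τ (+ i)
    top-code β τ ρ {i} i<C = trans
      (cong (λ p → window (proj₁ (proj₂ p)) (+ i)) (unpack-pack {2 ^ C} {2 ^ C} {W} (encodeBits C (β ∘ +_) , encodeBits C (τ ∘ +_) , ρ)))
      (decode-encodeBits C (τ ∘ +_) i<C)

    residue-code : ∀ β τ ρ → residue (code β τ ρ) ≡ ρ
    residue-code β τ ρ =
      cong (proj₂ ∘ proj₂) (unpack-pack {2 ^ C} {2 ^ C} {W} (encodeBits C (β ∘ +_) , encodeBits C (τ ∘ +_) , ρ))

    -- Makes `locate` total; the default `zero` is not met in the range of `locate-correct`.
    clamp : ℕ → Fin W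
    clamp n with n ℕ.<? W
    ... | yes n<W = fromℕ< n<W
    ... | no _ = zero

    toℕ-clamp : ∀ {n} → n ℕ.< W → toℕ (clamp n) ≡ n
    toℕ-clamp {n} n<W with n ℕ.<? W
    ... | yes p = toℕ-fromℕ< p
    ... | no n≮W = ⊥-elim (n≮W n<W)

    clamp-correct : ∀ z → 0ℤ ≤ z → 1ℤ + z ≤ + W → + toℕ (clamp ∣ z ∣) ≡ z
    clamp-correct (+ n) _ z<W = cong +_ (toℕ-clamp (ℤₚ.drop‿+≤+ z<W))

    -- Division with remainder by W for a quotient that can only be -1, 0 or 1.
    locate : ℤ → Fin W × Move
    locate z with 0ℤ ℤ.≤? z | + W ℤ.≤? z
    ... | no _ | _ = clamp ∣ z + + W ∣ , down
    ... | yes _ | no _ = clamp ∣ z ∣ , stay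
    ... | yes _ | yes _ = clamp ∣ z - + W ∣ , up

    offset : Move → ℤ
    offset down = - + W
    offset stay = 0ℤ
    offset up = + W

    locate-correct : ∀ z → - + W ≤ z → 1ℤ + z ≤ + W + + W → + toℕ (proj₁ (locate z)) + offset (proj₂ (locate z)) ≡ z
    locate-correct z -W≤z z<2W with 0ℤ ℤ.≤? z | + W ℤ.≤? z
    ... | no z≱0 | _ = trans
      (cong (_- + W) (clamp-correct (z + + W) (rearrange -W≤z (left z (+ W))) (rearrange (≰⇒1+≤ z≱0) (right z (+ W)))))
      (sym (i≡i+j-j z (+ W)))
      where
      left : ∀ z w → z - (- w) ≡ (z + w) - 0ℤ
      left z w = solve (z ∷ w ∷ [])
      right : ∀ z w → 0ℤ - (1ℤ + z) ≡ w - (1ℤ + (z + w))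
      right z w = solve (z ∷ w ∷ [])
    ... | yes 0≤z | no z≱W = trans (ℤₚ.+-identityʳ _) (clamp-correct z 0≤z (≰⇒1+≤ z≱W))
    ... | yes _ | yes W≤z = trans
      (cong (λ y → y + + W) (clamp-correct (z - + W) (rearrange W≤z (left z (+ W))) (rearrange z<2W (right z (+ W)))))
      (i-j+j≡i z (+ W))
      where
      left : ∀ z w → z - w ≡ (z - w) - 0ℤ
      left z w = solve (z ∷ w ∷ [])
      right : ∀ z w → (w + w) - (1ℤ + z) ≡ w - (1ℤ + (z - w))
      right z w = solve (z ∷ w ∷ [])

  T-ext : ∀ {a b} → (T a → T b) → (T b → T a) → a ≡ b
  T-ext {false} {false} f g = refl
  T-ext {false} {true} f g = ⊥-elim (g _)
  T-ext {true} {false} f g = ⊥-elim (f _)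
  T-ext {true} {true} f g = refl

  module Simulation (N B G D : ℕ) (D≤N : D ℕ.≤ N) where

    -- For z ≥ C the shifted point z - N still exceeds H + B, so that periodicity applies to it
    -- above a low point; hence C = B + H + N + 1.
    H C′ C : ℕ
    H = G ℕ.+ (D ℕ.+ D)
    C′ = B ℕ.+ H ℕ.+ N
    C = suc C′

    open Code C (C′ ℕ.+ C)

    -- Beyond the lower window, `extend` reads one period further down, while `decode` reads from
    -- the upper window, taking the residue for the largest point as is correct at level 0.
    extend decode : Fin m → PointSet
    extend q z = if ⌊ + C ℤ.≤? z ⌋ then bottom q (z - + N) else bottom q z
    decode q z = if ⌊ + C ℤ.≤? z ⌋ then top q (+ toℕ (residue q) - z) else bottom q z

    target : Fin m → List ℤ → ℤ
    target q s = + toℕ (residue q) + maxL s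

    -- The upper window is indexed by depth below the maximum: depth y arises from depth y - (max s
    -- - v) ≤ y. It needs no sign test, because from a positive level the positions concerned remain
    -- positive.
    δ : Fin m → List ℤ → Fin m × Move
    δ q s = Product.map₁ (code (after (extend q) s) (λ y → any (λ v → top q (y - (maxL s - v))) s)) (locate (target q s))

    -- `down` from level 0 means that the new maximum would be negative, so that no position
    -- remains.
    boundary : Fin m × Move → Maybe (Fin m × Bool)
    boundary (q , down) = nothing
    boundary (q , stay) = just (q , false)
    boundary (q , up) = just (q , true)

    δ₀ : Fin m → List ℤ → Maybe (Fin m × Bool)
    δ₀ q s = boundary
      (Product.map₁ (code (after (decode q) s) (λ y → after (decode q) s (target q s - y))) (locate (target q s)))

    accept : Fin m → ℤ
    accept q = if bottom q 0ℤ then 1ℤ else 0ℤ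

    height : Fin m → ℕ → ℤ
    height q l = + (l ℕ.* W ℕ.+ toℕ (residue q))

    record Tracks (R : PointSet) (q : Fin m) (l : ℕ) : Set where
      field
        profile : Profile H R (height q l)
        bottom≡ : ∀ {i} → i ℕ.< C → bottom q (+ i) ≡ R (+ i)
        top≡    : ∀ {i} → i ℕ.< C → top q (+ i) ≡ R (height q l - + i)

    module _ {R : PointSet} {q : Fin m} {l : ℕ} (tracks : Tracks R q l) where
      open Tracks tracks
      open Profile profile

      bottom-correct : ∀ z → 1ℤ + z ≤ + C → bottom q z ≡ R z
      bottom-correct (+ i) z<C = bottom≡ (ℤₚ.drop‿+≤+ z<C)
      bottom-correct -[1+ i ] _ = T-ext ⊥-elim (λ Rz → case′ (nonneg Rz))
        where
        case′ : 0ℤ ≤ -[1+ i ] → ⊥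
        case′ ()

      top-correct : ∀ z → 1ℤ + z ≤ + C → top q z ≡ R (height q l - z)
      top-correct (+ i) z<C = top≡ (ℤₚ.drop‿+≤+ z<C)
      top-correct -[1+ i ] _ = T-ext ⊥-elim (λ Rz →
        absurd (above Rz ⊞ +≤+ (z≤n {i})) (exceed (height q l) (+ i)))
        where
        exceed : ∀ h i → (h + i) - ((h - - (1ℤ + i)) + 0ℤ) ≡ -1ℤ
        exceed h i = solve (h ∷ i ∷ [])

      -- At level 0 the maximum is less than 2C, so every z ≥ C has depth less than C.
      decode-correct : l ≡ 0 → ∀ z → decode q z ≡ R z
      decode-correct refl z with + C ℤ.≤? z
      ... | no z≱C = bottom-correct z (≰⇒1+≤ z≱C)
      ... | yes C≤z = trans
        (top-correct (+ toℕ (residue q) - z) (rearrange (+≤+ (toℕ<n (residue q)) ⊞ C≤z) (bound z (+ C) (+ toℕ (residue q)))))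
        (cong R (reflect (+ toℕ (residue q)) z))
        where
        bound : ∀ z c ρ → ((c + c) + z) - ((1ℤ + ρ) + c) ≡ c - (1ℤ + (ρ - z))
        bound z c ρ = solve (z ∷ c ∷ ρ ∷ [])
        reflect : ∀ h z → h - (h - z) ≡ z
        reflect h z = solve (h ∷ z ∷ [])

      -- A step may descend by D, so points below C + D are needed. One shift by N ≥ D brings them
      -- into the lower window, and L ≥ 2C keeps them at least B below the maximum.
      extend-correct : Periodic N B ⟪ R ⟫ → + W ≤ height q l → ∀ z → 1ℤ + z ≤ + C + + D → extend q z ≡ R z
      extend-correct periodic W≤L z z<C+D with + C ℤ.≤? z
      ... | no z≱C = bottom-correct z (≰⇒1+≤ z≱C)
      ... | yes C≤z = trans
        (bottom-correct (z - + N) (rearrange (z<C+D ⊞ +≤+ D≤N) (left z (+ C) (+ D) (+ N))))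
        (trans (T-ext (proj₁ invariant) (proj₂ invariant)) (cong R (i-j+j≡i z (+ N))))
        where
        left : ∀ z c d n → ((c + d) + n) - ((1ℤ + z) + d) ≡ c - (1ℤ + (z - n))
        left z c d n = solve (z ∷ c ∷ d ∷ n ∷ [])
        lower : ∀ r z h b n → (h + (z + 1ℤ)) - (r + ((1ℤ + (b + h + n)) + 0ℤ)) ≡ (z - n) - (r + b)
        lower r z h b n = solve (r ∷ z ∷ h ∷ b ∷ n ∷ [])
        upper : ∀ z L h b n d →
          (((1ℤ + (b + h + n)) + d) + (L + (n + (h + (1ℤ + 1ℤ))))) -
          ((1ℤ + z) + (((1ℤ + (b + h + n)) + (1ℤ + (b + h + n))) + (d + (0ℤ + (0ℤ + 0ℤ))))) ≡ L - ((z - n) + n + b)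
        upper z L h b n d = solve (z ∷ L ∷ h ∷ b ∷ n ∷ d ∷ [])
        invariant : (⟪ R ⟫ (z - + N) → ⟪ R ⟫ (z - + N + + N)) × (⟪ R ⟫ (z - + N + + N) → ⟪ R ⟫ (z - + N))
        invariant = let r , Rr , r≤H = low in
          periodic r (height q l) (z - + N) Rr peak
            (rearrange (r≤H ⊞ C≤z ⊞ +≤+ (z≤n {1})) (lower r z (+ H) (+ B) (+ N)))
            (rearrange (z<C+D ⊞ W≤L ⊞ +≤+ D≤N ⊞ +≤+ (z≤n {H}) ⊞ +≤+ (z≤n {1}) ⊞ +≤+ (z≤n {1}))
              (upper z (height q l) (+ H) (+ B) (+ N) (+ D)))

    tracks-code : ∀ {R} β τ ρ l → Profile H R (+ (l ℕ.* W ℕ.+ toℕ ρ)) → (∀ {i} → i ℕ.< C → β (+ i) ≡ R (+ i)) →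
      (∀ {i} → i ℕ.< C → τ (+ i) ≡ R (+ (l ℕ.* W ℕ.+ toℕ ρ) - + i)) → Tracks R (code β τ ρ) l
    tracks-code {R} β τ ρ l profile bottom≡ top≡ = record
      { profile = subst (Profile H R) height≡ profile
      ; bottom≡ = λ i<C → trans (bottom-code β τ ρ i<C) (bottom≡ i<C)
      ; top≡ = λ {i} i<C → trans (top-code β τ ρ i<C) (trans (top≡ i<C) (cong (λ h → R (h - + i)) height≡)) }
      where
      height≡ : + (l ℕ.* W ℕ.+ toℕ ρ) ≡ height (code β τ ρ) l
      height≡ = cong (λ r → + (l ℕ.* W ℕ.+ toℕ r)) (sym (residue-code β τ ρ))

    level-move : ∀ v l r → + (move v l ℕ.* W ℕ.+ r) ≡ + (suc l ℕ.* W) + (+ r + offset v)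
    level-move down l r = cancel (+ W) (+ (l ℕ.* W)) (+ r)
      where
      cancel : ∀ w x r → x + r ≡ (w + x) + (r + - w)
      cancel w x r = solve (w ∷ x ∷ r ∷ [])
    level-move stay l r = cong (λ y → + (suc l ℕ.* W) + y) (sym (ℤₚ.+-identityʳ (+ r)))
    level-move up l r = regroup (+ W) (+ (l ℕ.* W)) (+ r)
      where
      regroup : ∀ w x r → (w + (w + x)) + r ≡ (w + x) + (r + w)
      regroup w x r = solve (w ∷ x ∷ r ∷ [])

    module _ {R : PointSet} {q : Fin m} {l : ℕ} (tracks : Tracks R q l) (dense : Dense G ⟪ R ⟫)
      {s : List ℤ} (s≢[] : ¬ s ≡ []) (∣s∣≤D : ∀ {v} → v ∈ s → ∣ v ∣ ℕ.≤ D) (min≤0 : minL s ≤ 0ℤ) where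
      open Tracks tracks
      open Profile profile
      open StepProfile dense s≢[] ∣s∣≤D min≤0 profile

      private
        μ z : ℤ
        μ = maxL s
        z = target q s

        μ≤D : μ ≤ + D
        μ≤D = ∣∣≤⇒≤ μ (∣s∣≤D (maxL-∈ s s≢[]))

        -D≤μ : - + D ≤ μ
        -D≤μ = ∣∣≤⇒-≤ μ (∣s∣≤D (maxL-∈ s s≢[]))

        D≤C : D ℕ.≤ C
        D≤C = ℕₚ.≤-trans D≤N (ℕₚ.≤-trans (ℕₚ.m≤n+m N (B ℕ.+ H)) (ℕₚ.n≤1+n C′))

        D≤W : D ℕ.≤ W
        D≤W = ℕₚ.≤-trans D≤C (ℕₚ.m≤m+n C C)

        -- A step changes the maximum by at most D ≤ W, hence the level by at most 1.
        located : + toℕ (proj₁ (locate z)) + offset (proj₂ (locate z)) ≡ z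
        located = locate-correct z
          (rearrange (-D≤μ ⊞ +≤+ D≤W ⊞ +≤+ (z≤n {toℕ (residue q)})) (lower (+ toℕ (residue q)) (maxL s) (+ D) (+ W)))
          (rearrange (+≤+ (toℕ<n (residue q)) ⊞ μ≤D ⊞ +≤+ D≤W) (upper (+ toℕ (residue q)) (maxL s) (+ D) (+ W)))
          where
          lower : ∀ ρ μ d w → (μ + (w + ρ)) - (- d + (d + 0ℤ)) ≡ (ρ + μ) - (- w)
          lower ρ μ d w = solve (ρ ∷ μ ∷ d ∷ w ∷ [])
          upper : ∀ ρ μ d w → (w + (d + w)) - ((1ℤ + ρ) + (μ + d)) ≡ (w + w) - (1ℤ + (ρ + μ))
          upper ρ μ d w = solve (ρ ∷ μ ∷ d ∷ w ∷ [])

        after-top : ∀ L′ → L′ ≡ height q l + μ → + C ≤ L′ → ∀ {i} → i ℕ.< C →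
          any (λ v → top q (+ i - (μ - v))) s ≡ after R s (L′ - + i)
        after-top L′ L′≡ C≤L′ {i} i<C with 0ℤ ℤ.≤? L′ - + i
        -- The sign test in `after` cannot fail, since i < C ≤ L′.
        ... | no 0≰ = ⊥-elim (0≰ (rearrange (+≤+ i<C ⊞ C≤L′ ⊞ +≤+ (z≤n {1})) (positive (+ C) (+ i) L′)))
          where
          positive : ∀ c i L → (c + (L + 1ℤ)) - ((1ℤ + i) + (c + 0ℤ)) ≡ (L - i) - 0ℤ
          positive c i L = solve (c ∷ i ∷ L ∷ [])
        ... | yes _ = any-cong s (λ v v∈ → trans
          (top-correct tracks (+ i - (μ - v)) (rearrange (+≤+ i<C ⊞ ≤-maxL s v∈) (bound (+ i) (maxL s) v (+ C))))
          (cong R (trans (reflect (height q l) (+ i) (maxL s) v) (cong (λ h → h - + i - v) (sym L′≡)))))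
          where
          bound : ∀ i μ v c → (c + μ) - ((1ℤ + i) + v) ≡ c - (1ℤ + (i - (μ - v)))
          bound i μ v c = solve (i ∷ μ ∷ v ∷ c ∷ [])
          reflect : ∀ h i μ v → h - (i - (μ - v)) ≡ (h + μ) - i - v
          reflect h i μ v = solve (h ∷ i ∷ μ ∷ v ∷ [])

      tracks-interior : ∀ l′ → l ≡ suc l′ → Periodic N B ⟪ R ⟫ → Tracks (after R s) (proj₁ (δ q s)) (move (proj₂ (δ q s)) l′)
      tracks-interior l′ refl periodic =
        tracks-code (after (extend q) s) (λ y → any (λ v → top q (y - (μ - v))) s) ρ′ (move v l′)
        (subst (Profile H (after R s)) (sym L′≡) (profile-after (ℤₚ.≤-trans (+≤+ z≤n) C≤L+μ)))
        (λ {i} i<C → after-cong (extend q) R s (+ i) (λ u u∈ → extend-correct tracks periodic W≤L (+ i - u)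
          (rearrange (+≤+ i<C ⊞ ∣∣≤⇒-≤ u (∣s∣≤D u∈)) (bound (+ i) u (+ C) (+ D)))))
        (after-top _ L′≡ (subst (+ C ≤_) (sym L′≡) C≤L+μ))
        where
        ρ′ : Fin W
        ρ′ = proj₁ (locate z)

        v : Move
        v = proj₂ (locate z)

        L′≡ : + (move v l′ ℕ.* W ℕ.+ toℕ ρ′) ≡ height q (suc l′) + μ
        L′≡ = trans (level-move v l′ (toℕ ρ′)) (trans (cong (λ y → + (suc l′ ℕ.* W) + y) located)
          (sym (ℤₚ.+-assoc (+ (suc l′ ℕ.* W)) (+ toℕ (residue q)) (maxL s))))

        W≤L : + W ≤ height q (suc l′)
        W≤L = +≤+ (ℕₚ.≤-trans (ℕₚ.m≤m+n W (l′ ℕ.* W)) (ℕₚ.m≤m+n _ _))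

        -- From L ≥ 2C and max s ≥ -D ≥ -C: the new set is not empty and its upper window lies above
        -- 0.
        C≤L+μ : + C ≤ height q (suc l′) + μ
        C≤L+μ = rearrange (W≤L ⊞ +≤+ D≤C ⊞ -D≤μ) (high (+ C) (+ D) (height q (suc l′)) (maxL s))
          where
          high : ∀ c d h μ → (h + (c + μ)) - ((c + c) + (d + - d)) ≡ (h + μ) - c
          high c d h μ = solve (c ∷ d ∷ h ∷ μ ∷ [])

        bound : ∀ i u c d → (c + u) - ((1ℤ + i) + - d) ≡ (c + d) - (1ℤ + (i - u))
        bound i u c d = solve (i ∷ u ∷ c ∷ d ∷ [])

      Boundary : Maybe (Fin m × Bool) → Set
      Boundary nothing = ∀ x → ¬ ⟪ after R s ⟫ x
      Boundary (just (q′ , b)) = Tracks (after R s) q′ (if b then 1 else 0)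

      tracks-boundary : l ≡ 0 → Boundary (δ₀ q s)
      tracks-boundary refl = go (locate z) located
        where
        decoded : ∀ y → after (decode q) s y ≡ after R s y
        decoded y = after-cong (decode q) R s y (λ v _ → decode-correct tracks refl (y - v))

        tracks-at : ∀ ρ′ b → + ((if b then 1 else 0) ℕ.* W ℕ.+ toℕ ρ′) ≡ z →
          Tracks (after R s) (code (after (decode q) s) (λ y → after (decode q) s (z - y)) ρ′) (if b then 1 else 0)
        tracks-at ρ′ b L′≡ =
          tracks-code (after (decode q) s) (λ y → after (decode q) s (z - y)) ρ′ (if b then 1 else 0)
          (subst (Profile H (after R s)) (sym L′≡) (profile-after (subst (0ℤ ≤_) L′≡ (+≤+ z≤n))))
          (λ {i} _ → decoded (+ i)) (λ {i} _ → trans (decoded (z - + i)) (cong (λ h → after R s (h - + i)) (sym L′≡)))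

        go : ∀ p → + toℕ (proj₁ p) + offset (proj₂ p) ≡ z →
          Boundary (boundary (Product.map₁ (code (after (decode q) s) (λ y → after (decode q) s (z - y))) p))
        -- The new maximum would be ρ′ - W < 0, whereas every point after a step is at least 0.
        go (ρ′ , down) eq x p = absurd
          (+≤+ (toℕ<n ρ′) ⊞ ℤₚ.≤-reflexive (sym eq) ⊞ after-above p ⊞ proj₁ (after⁻ R s p))
          (negative (+ toℕ ρ′) (+ W) z x)
          where
          negative : ∀ ρ w z x → (w + (ρ + - w + (z + x))) - ((1ℤ + ρ) + (z + (x + 0ℤ))) ≡ -1ℤ
          negative ρ w z x = solve (ρ ∷ w ∷ z ∷ x ∷ [])
        go (ρ′ , stay) eq = tracks-at ρ′ false (trans (sym (ℤₚ.+-identityʳ _)) eq)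
        go (ρ′ , up) eq = tracks-at ρ′ true (trans (regroup (+ W) (+ toℕ ρ′)) eq)
          where
          regroup : ∀ w r → (w + 0ℤ) + r ≡ r + w
          regroup w r = solve (w ∷ r ∷ [])

open import Defs
open CounterAutomata
open TypeGeometry
open UniformStructure
open ReachableSets
open ProfileCodes
open import Data.Bool using (true; false; T; if_then_else_)
open import Data.Nat as ℕ using (ℕ; zero; suc; z≤n; s≤s)
import Data.Nat.Properties as ℕₚ
open import Data.Fin using (Fin; zero)
open import Data.Integer using (ℤ; +_; 0ℤ; 1ℤ; _+_; _-_; _≤_)
open import Data.List as List using (List; []; _∷_; _∷ʳ_; length; map; concatMap; foldl; foldr)
import Data.List.Properties as Listₚ
open import Data.List.Relation.Binary.Disjoint.Propositional using (Disjoint)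
open import Data.List.Membership.Propositional using (_∈_; lose; find)
open import Data.List.Membership.Propositional.Properties using (∈-map⁺; ∈-map⁻; ∈-concatMap⁺; ∈-concatMap⁻)
open import Data.List.Relation.Unary.All as All using (All; []; _∷_)
import Data.List.Relation.Unary.All.Properties as Allₚ
open import Data.List.Relation.Unary.AllPairs as AllPairs using ([]; _∷_)
import Data.List.Relation.Unary.AllPairs.Properties as AllPairsₚ
open import Data.List.Relation.Unary.Any as Any using (Any; here; there)
open import Data.List.Relation.Unary.Unique.Propositional using (Unique)
import Data.List.Relation.Unary.Unique.Propositional.Properties as Uniqueₚ
open import Data.Maybe as Maybe using (Maybe; just; nothing)
open import Data.Product as Product using (∃; _×_; _,_; proj₁; proj₂)
open import Data.Empty using (⊥-elim)
open import Function using (_∘_)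
open import Function.Bundles using (Equivalence)
open import Function.Construct.Composition using (_⇔-∘_)
open import Relation.Nullary using (¬_)
open import Relation.Binary.PropositionalEquality using (_≡_; _≢_; refl; sym; trans; cong; cong₂; subst)

-- Counting N-excursions by the automaton.

module Counting (S : List (List ℤ)) where

  -- The recursion carries the whole reachable set, so an N-walk is listed once, however many
  -- excursions are compatible with it.
  excursions : PointSet → ℕ → List (List (List ℤ))
  excursions R zero = if R 0ℤ then [] ∷ [] else []
  excursions R (suc n) = concatMap (λ s → map (s ∷_) (excursions (after R s) n)) S

  ∈-excursions⁻ : ∀ R n {w} → w ∈ excursions R n → length w ≡ n × IsNWalk S w × ⟪ foldl after R w ⟫ 0ℤ
  ∈-excursions⁻ R zero w∈ with R 0ℤ in eq
  ∈-excursions⁻ R zero (here refl) | true = refl , [] , subst T (sym eq) _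
  ∈-excursions⁻ R (suc n) w∈ =
    let s , s∈ , w∈s = find (∈-concatMap⁻ (λ s → map (s ∷_) (excursions (after R s) n)) w∈)
        w′ , w′∈ , eq = ∈-map⁻ (s ∷_) w∈s
        length≡ , walk , reached = ∈-excursions⁻ (after R s) n w′∈
    in subst (λ w → length w ≡ suc n × IsNWalk S w × ⟪ foldl after R w ⟫ 0ℤ) (sym eq)
         (cong suc length≡ , s∈ ∷ walk , reached)

  ∈-excursions⁺ : ∀ R {w} → IsNWalk S w → ⟪ foldl after R w ⟫ 0ℤ → w ∈ excursions R (length w)
  ∈-excursions⁺ R {[]} [] p with R 0ℤ
  ... | true = here refl
  ∈-excursions⁺ R {s ∷ w} (s∈ ∷ walk) p = ∈-concatMap⁺ (λ s → map (s ∷_) (excursions (after R s) (length w)))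
    (lose s∈ (∈-map⁺ (s ∷_) (∈-excursions⁺ (after R s) walk p)))

  excursions-unique : Unique S → ∀ R n → Unique (excursions R n)
  excursions-unique S! R zero with R 0ℤ
  ... | true = [] ∷ []
  ... | false = []
  excursions-unique S! R (suc n) = Uniqueₚ.concat⁺
    (Allₚ.map⁺ (All.universal (λ s → Uniqueₚ.map⁺ Listₚ.∷-injectiveʳ (excursions-unique S! (after R s) n)) S))
    (AllPairsₚ.map⁺ (AllPairs.map disjoint S!))
    where
    disjoint : ∀ {s s′} → s ≢ s′ →
      Disjoint (map (s ∷_) (excursions (after R s) n)) (map (s′ ∷_) (excursions (after R s′) n))
    disjoint {s} {s′} s≢s′ (p , q) =
      let _ , _ , eq = ∈-map⁻ (s ∷_) p
          _ , _ , eq′ = ∈-map⁻ (s′ ∷_) q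
      in s≢s′ (Listₚ.∷-injectiveˡ (trans (sym eq) eq′))

  length-concatMap : ∀ {A : Set} (g : A → List (List (List ℤ))) xs →
    + length (concatMap g xs) ≡ ℤL.lsum (λ x → + length (g x)) xs
  length-concatMap g [] = refl
  length-concatMap g (x ∷ xs) = trans (cong +_ (Listₚ.length-++ (g x))) (cong (λ y → + length (g x) + y) (length-concatMap g xs))

  length-excursions : ∀ R n → + length (excursions R (suc n)) ≡ ℤL.lsum (λ s → + length (excursions (after R s) n)) S
  length-excursions R n = trans (length-concatMap (λ s → map (s ∷_) (excursions (after R s) n)) S)
    (lsum-cong S (λ s _ → cong +_ (Listₚ.length-map (s ∷_) (excursions (after R s) n))))
    where
    lsum-cong : ∀ {f g : List ℤ → ℤ} xs → (∀ x → x ∈ xs → f x ≡ g x) → ℤL.lsum f xs ≡ ℤL.lsum g xs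
    lsum-cong [] h = refl
    lsum-cong (x ∷ xs) h = cong₂ _+_ (h x (here refl)) (lsum-cong xs (λ y y∈ → h y (there y∈)))

theorem5p4 : (S : List (List ℤ)) → IsNStepSet S
    → (∀ s → s ∈ S → minL s ≤ 0ℤ)
    → (∃ λ (types : List TypeParams) →
    ∀ w → IsNMeander S w → Any (InType (Reachable w)) types)
    → ∃ λ (f : ℕ → ℕ) →
    (∀ n → IsNExcursionCount S n (f n)) × IsAlgebraic (λ n → + (f n))
theorem5p4 S (steps , S!) min≤0 (types , typed) =
  (λ n → length (excursions origin n)) , is-count ,
  IsAlgebraic-resp (λ n → sym (excursions≡run n [] [] (just (q₀ , 0)) tracks-origin)) (run-algebraic q₀)
  where
  open Counting S

  N₀ B G D N : ℕ
  N₀ = proj₁ (uniform-structure types)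
  B = proj₁ (proj₂ (uniform-structure types))
  G = proj₁ (proj₂ (proj₂ (uniform-structure types)))
  D = foldr (λ s d → magnitude s ℕ.+ d) 0 S
  -- A multiple of the common period that is at least D, so that one shift suffices in `extend`.
  N = suc D ℕ.* N₀

  D≤N : D ℕ.≤ N
  D≤N = ℕₚ.≤-trans (ℕₚ.n≤1+n D) (ℕₚ.≤-trans (ℕₚ.≤-reflexive (sym (ℕₚ.*-identityʳ (suc D))))
    (ℕₚ.*-monoʳ-≤ (suc D) (proj₁ (proj₂ (proj₂ (proj₂ (uniform-structure types)))))))

  magnitude≤D : ∀ {s} → s ∈ S → magnitude s ℕ.≤ D
  magnitude≤D = go S
    where
    go : ∀ {s} S → s ∈ S → magnitude s ℕ.≤ foldr (λ s d → magnitude s ℕ.+ d) 0 S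
    go (s ∷ S) (here refl) = ℕₚ.m≤m+n (magnitude s) _
    go (s ∷ S) (there s∈) = ℕₚ.≤-trans (go S s∈) (ℕₚ.m≤n+m _ (magnitude s))

  open Simulation N B G D D≤N
  open Code C (C′ ℕ.+ C)
  open CounterAutomaton S δ δ₀ accept using (Configuration; step; run; run-algebraic)

  -- The hypothesis on types concerns N-meanders, and a reachable point exhibits w as one. In
  -- `periodic` and `dense` the point `lo` takes this role.
  structure : ∀ w → IsNWalk S w → ∀ {x} → ⟪ reach w ⟫ x → Periodic N₀ B ⟪ reach w ⟫ × Dense G ⟪ reach w ⟫
  structure w walk {x} p =
    let vs , compatible , meander , _ = Equivalence.to (reach⇔Reachable w x) p in
    proj₂ (proj₂ (proj₂ (proj₂ (uniform-structure types)))) (Any.map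
      (λ (m , j , k≤j , Reachable⇔) → m , j , k≤j , λ y → Reachable⇔ y ⇔-∘ reach⇔Reachable w y)
      (typed w (walk , vs , compatible , meander)))

  periodic : ∀ w → IsNWalk S w → Periodic N B ⟪ reach w ⟫
  periodic w walk lo hi x lo∈ = Periodic-multiple (suc D) (proj₁ (structure w walk lo∈)) lo hi x lo∈

  dense : ∀ w → IsNWalk S w → Dense G ⟪ reach w ⟫
  dense w walk lo hi z lo∈ = proj₂ (structure w walk lo∈) lo hi z lo∈

  Related : PointSet → Configuration → Set
  Related R nothing = ∀ x → ¬ ⟪ R ⟫ x
  Related R (just (q , l)) = Tracks R q l

  related-step : ∀ w → IsNWalk S w → ∀ c → Related (reach w) (just c) → ∀ {s} → s ∈ S → Related (after (reach w) s) (step c s)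
  related-step w walk (q , zero) tracks {s} s∈ = go (δ₀ q s)
    (tracks-boundary tracks (dense w walk) (proj₁ (All.lookup steps s∈))
      (λ v∈ → ℕₚ.≤-trans (∈⇒∣∣≤magnitude v∈) (magnitude≤D s∈)) (min≤0 s s∈) refl)
    where
    -- `step` maps over the result of `δ₀` and computes only when that result is split.
    go : ∀ c → Boundary tracks (dense w walk) (proj₁ (All.lookup steps s∈))
      (λ v∈ → ℕₚ.≤-trans (∈⇒∣∣≤magnitude v∈) (magnitude≤D s∈)) (min≤0 s s∈) c →
      Related (after (reach w) s) (Maybe.map (Product.map₂ (λ b → if b then 1 else 0)) c)
    go nothing p = p
    go (just _) p = p
  related-step w walk (q , suc l) tracks {s} s∈ =
    tracks-interior tracks (dense w walk) (proj₁ (All.lookup steps s∈))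
      (λ v∈ → ℕₚ.≤-trans (∈⇒∣∣≤magnitude v∈) (magnitude≤D s∈)) (min≤0 s s∈) l refl (periodic w walk)

  -- Steps keep an empty set empty, as the configuration `nothing` is absorbing.
  excursions-empty : ∀ n R → (∀ x → ¬ ⟪ R ⟫ x) → + length (excursions R n) ≡ 0ℤ
  excursions-empty zero R empty with R 0ℤ in eq
  ... | true = ⊥-elim (empty 0ℤ (subst T (sym eq) _))
  ... | false = refl
  excursions-empty (suc n) R empty = trans (length-excursions R n) (go S)
    where
    go : ∀ S′ → ℤL.lsum (λ s → + length (excursions (after R s) n)) S′ ≡ 0ℤ
    go [] = refl
    go (s ∷ S′) = cong₂ _+_ (excursions-empty n (after R s)
      (λ x p → let _ , _ , _ , q = after⁻ R s p in empty _ q)) (go S′)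

  -- The set is kept in the form `reach w`, because periodicity and density are known for reachable
  -- sets of N-walks; the recursion on n lengthens w at its end.
  excursions≡run : ∀ n w → IsNWalk S w → ∀ c → Related (reach w) c → + length (excursions (reach w) n) ≡ run n c
  excursions≡run n w walk nothing empty = excursions-empty n (reach w) empty
  excursions≡run zero w walk (just (q , l)) tracks = trans (go (reach w 0ℤ))
    -- As C is positive, position 0 belongs to the lower window and acceptance can be read off the
    -- state.
    (cong (λ b → if b then 1ℤ else 0ℤ) (sym (Tracks.bottom≡ tracks (s≤s z≤n))))
    where
    go : ∀ b → + length (if b then [] ∷ [] else ([] {A = List (List ℤ)})) ≡ (if b then 1ℤ else 0ℤ)
    go true = refl
    go false = refl
  excursions≡run (suc n) w walk (just c) tracks = trans (length-excursions (reach w) n) (go S (λ s∈ → s∈))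
    where
    go : ∀ S′ → (∀ {s} → s ∈ S′ → s ∈ S) →
      ℤL.lsum (λ s → + length (excursions (after (reach w) s) n)) S′ ≡ ℤL.lsum (λ s → run n (step c s)) S′
    go [] _ = refl
    go (s ∷ S′) S′⊆S = cong₂ _+_
      (trans (cong (λ R → + length (excursions R n)) (sym snoc))
        (excursions≡run n (w ∷ʳ s) (Allₚ.∷ʳ⁺ walk s∈) (step c s)
          (subst (λ R → Related R (step c s)) (sym snoc) (related-step w walk c tracks s∈))))
      (go S′ (S′⊆S ∘ there))
      where
      s∈ : s ∈ S
      s∈ = S′⊆S (here refl)
      snoc : reach (w ∷ʳ s) ≡ after (reach w) s
      snoc = Listₚ.foldl-∷ʳ after origin s w

  q₀ : Fin m
  q₀ = code origin (λ y → origin (0ℤ - y)) zero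

  tracks-origin : Tracks origin q₀ 0
  tracks-origin = tracks-code origin (λ y → origin (0ℤ - y)) zero 0 profile-origin (λ _ → refl) (λ _ → refl)

  is-count : ∀ n → IsNExcursionCount S n (length (excursions origin n))
  is-count n = excursions origin n , excursions-unique S! origin n , All.tabulate sound , complete , refl
    where
    sound : ∀ {w} → w ∈ excursions origin n → length w ≡ n × IsNExcursion S w
    sound {w} w∈ =
      let length≡ , walk , reached = ∈-excursions⁻ origin n w∈
          vs , compatible , meander , end = Equivalence.to (reach⇔Reachable w 0ℤ) reached
      in length≡ , walk , vs , compatible , meander , end

    complete : ∀ w → length w ≡ n → IsNExcursion S w → w ∈ excursions origin n
    complete w refl (walk , vs , compatible , meander , end) =
      ∈-excursions⁺ origin walk (Equivalence.from (reach⇔Reachable w 0ℤ) (vs , compatible , meander , end))
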